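{- Let $n\ge 6$ and let $\Pi_n\subseteq\mathbb{R}^n$ be the permutahedron. Then there is no symmetric extended formulation of $\Pi_n$ (symmetric with respect to the group $G=S_n$ acting on the vertex set of $\Pi_n$ by permuting coordinates) with fewer than $\frac{n(n-1)}{4}$ variables and constraints, i.e. for every such formulation the number of its variables plus the number of its constraints is at least $\frac{n(n-1)}{4}$.
   Context: The permutahedron $\Pi_n$ is the convex hull of all points of $\mathbb{R}^n$ obtained from $(1,2,\dots,n)$ by permuting coordinates; its vertex set is $X=\{(\zeta^{ -1}(1),\dots,\zeta^{ -1}(n)) : \zeta\in S_n\}$. The group $S_n$ acts on $\mathbb{R}^n$ (and on $X$) by $(\pi.x)_v=x_{\pi^{ -1}(v)}$; similarly $S_d$ acts on $\mathbb{R}^d$ by permuting coordinates. An extension of a polytope $P\subseteq\mathbb{R}^m$ is a polyhedron $Q\subseteq\mathbb{R}^d$ together with a linear map $p:\mathbb{R}^d\to\mathbb{R}^m$ with $p(Q)=P$; an extended formulation of $P$ is a finite system $A^{=}y=b^{=}$, $A^{\le}y\le b^{\le}$ whose solution set $Q$ is an extension of $P$ (with some linear map $p$). Such an extended formulation is symmetric with respect to a group $G\subseteq S_m$ acting on the vertex set $X$ of $P$ if for every $\pi\in G$ there are a permutation $\varkappa_\pi\in S_d$ with $p(\varkappa_\pi.y)=\pi.p(y)$ for all $y\in p^{ -1}(X)$, and permutations $\varrho^{=}_\pi,\varrho^{\le}_\pi$ of the rows of $(A^{=},b^{=})$ and $(A^{\le},b^{\le})$ respectively, such that simultaneously permuting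 the columns (of $A^{=}$, $A^{\le}$) by $\varkappa_\pi$ and the rows by $\varrho^{=}_\pi$, $\varrho^{\le}_\pi$ leaves $(A^{=},b^{=})$ and $(A^{\le},b^{\le})$ unchanged. -}

module Defs where

open import Algebra.Bundles using (CommutativeRing)
open import Algebra.Module.Bundles.Raw using (RawModule)
open import Algebra.Module.Morphism.Structures using (module ModuleMorphisms)
import Algebra.Definitions.RawMonoid as RawMonoidDefinitions
open import Data.Fin.Base using (Fin; toℕ)
open import Data.Fin.Permutation using (Permutation′; _⟨$⟩ˡ_)
open import Data.Nat.Base as ℕ using (ℕ)
open import Data.Product.Base using (∃; _×_)
open import Data.Vec.Functional using (Vector; map; zipWith; replicate)
open import Data.Vec.Functional.Relation.Binary.Pointwise using (Pointwise)
open import Level using (Level; _⊔_; suc)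
open import Relation.Binary.Core using (Rel)
open import Relation.Binary.Structures using (IsStrictTotalOrder)
import Relation.Binary.Construct.StrictToNonStrict as StrictToNonStrict
open import Relation.Nullary using (¬_)
open import Relation.Unary using (Pred; _∈_; _≐_; Satisfiable)

-- The real numbers, axiomatised (up to unique isomorphism, classically) as a
-- Dedekind complete ordered field.  The order is trichotomous, as usual in
-- classical mathematics.
record RealField c ℓ₁ ℓ₂ : Set (suc (c ⊔ ℓ₁ ⊔ ℓ₂)) where
  infix 4 _<_
  field
    commutativeRing : CommutativeRing c ℓ₁

  open CommutativeRing commutativeRing public

  field
    _<_                : Rel Carrier ℓ₂
    isStrictTotalOrder : IsStrictTotalOrder _≈_ _<_
    0≉1                : ¬ (0# ≈ 1#)
    inverse            : ∀ x → ¬ (x ≈ 0#) → ∃ λ y → x * y ≈ 1#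
    +-monoˡ-<          : ∀ z {x y} → x < y → x + z < y + z
    *-pos              : ∀ {x y} → 0# < x → 0# < y → 0# < x * y

  open StrictToNonStrict _≈_ _<_ public using (_≤_)

  UpperBound : ∀ {p} → Pred Carrier p → Pred Carrier (c ⊔ ℓ₁ ⊔ ℓ₂ ⊔ p)
  UpperBound S u = ∀ x → x ∈ S → x ≤ u

  field
    supremum : (S : Pred Carrier (c ⊔ ℓ₁ ⊔ ℓ₂)) →
               Satisfiable S → Satisfiable (UpperBound S) →
               ∃ λ s → UpperBound S s × (∀ u → UpperBound S u → s ≤ u)

-- For vectors this is (π . x)_v = x_{π⁻¹(v)}; applied to a vector of rows it
-- permutes the rows of a matrix.
infixr 7 _•_
_•_ : ∀ {a} {A : Set a} {n} → Permutation′ n → Vector A n → Vector A n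
(π • x) v = x (π ⟨$⟩ˡ v)

module Polyhedra {c ℓ₁ ℓ₂} (ℝ : RealField c ℓ₁ ℓ₂) where

  open RealField ℝ
  open RawMonoidDefinitions +-rawMonoid using (sum) renaming (_×_ to _×ℝ_)

  ℝ^_ : ℕ → Set c
  ℝ^ n = Vector Carrier n

  Matrix : ℕ → ℕ → Set c
  Matrix m n = Vector (ℝ^ n) m

  infix 4 _≈ᵛ_ _≤ᵛ_ _≈ᴹ_
  _≈ᵛ_ : ∀ {n} → Rel (ℝ^ n) ℓ₁
  _≈ᵛ_ = Pointwise _≈_

  _≤ᵛ_ : ∀ {n} → Rel (ℝ^ n) (ℓ₁ ⊔ ℓ₂)
  _≤ᵛ_ = Pointwise _≤_

  _≈ᴹ_ : ∀ {m n} → Rel (Matrix m n) ℓ₁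
  _≈ᴹ_ = Pointwise _≈ᵛ_

  infixr 8 _*ᵛ_
  _*ᵛ_ : ∀ {m n} → Matrix m n → ℝ^ n → ℝ^ m
  (A *ᵛ y) i = sum (zipWith _*_ (A i) y)

  ℝ^-rawModule : ℕ → RawModule Carrier c ℓ₁
  ℝ^-rawModule n = record
    { Carrierᴹ = ℝ^ n
    ; _≈ᴹ_     = _≈ᵛ_
    ; _+ᴹ_     = zipWith _+_
    ; _*ₗ_     = λ a → map (a *_)
    ; _*ᵣ_     = λ x a → map (_* a) x
    ; 0ᴹ       = replicate _ 0#
    ; -ᴹ_      = map (-_)
    }

  IsLinear : ∀ {m n} → (ℝ^ m → ℝ^ n) → Set (c ⊔ ℓ₁)
  IsLinear {m} {n} =
    ModuleMorphisms.IsModuleHomomorphism (ℝ^-rawModule m) (ℝ^-rawModule n)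

  Image : ∀ {m n q} → (ℝ^ m → ℝ^ n) → Pred (ℝ^ m) q → Pred (ℝ^ n) (c ⊔ ℓ₁ ⊔ q)
  Image p Q x = ∃ λ y → y ∈ Q × p y ≈ᵛ x

  record ConvexHull {n s} (S : Pred (ℝ^ n) s) (x : ℝ^ n) : Set (c ⊔ ℓ₁ ⊔ ℓ₂ ⊔ s) where
    field
      k           : ℕ
      point       : Fin k → ℝ^ n
      weight      : Fin k → Carrier
      point∈S     : ∀ j → point j ∈ S
      weight≥0    : ∀ j → 0# ≤ weight j
      weight-sum  : sum weight ≈ 1#
      combination : x ≈ᵛ (λ v → sum (λ j → weight j * point j v))

  record System (d : ℕ) : Set c where
    field
      m⁼ m≤ : ℕ
      A⁼    : Matrix m⁼ d
      b⁼    : ℝ^ m⁼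
      A≤    : Matrix m≤ d
      b≤    : ℝ^ m≤

    numConstraints : ℕ
    numConstraints = m⁼ ℕ.+ m≤

    Solutions : Pred (ℝ^ d) (ℓ₁ ⊔ ℓ₂)
    Solutions y = (A⁼ *ᵛ y ≈ᵛ b⁼) × (A≤ *ᵛ y ≤ᵛ b≤)

  record ExtendedFormulation {m r} (P : Pred (ℝ^ m) r) : Set (c ⊔ ℓ₁ ⊔ ℓ₂ ⊔ r) where
    field
      numVariables : ℕ
      system       : System numVariables
    open System system public
    field
      p        : ℝ^ numVariables → ℝ^ m
      p-linear : IsLinear p
      p[Q]≐P   : Image p Solutions ≐ P

  record Invariance {m r x} {P : Pred (ℝ^ m) r} (X : Pred (ℝ^ m) x)
                    (E : ExtendedFormulation P) (π : Permutation′ m)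
                    : Set (c ⊔ ℓ₁ ⊔ x) where
    open ExtendedFormulation E
    field
      κ       : Permutation′ numVariables
      ϱ⁼      : Permutation′ m⁼
      ϱ≤      : Permutation′ m≤
      -- y ranges over the whole preimage p⁻¹(X) in ℝ^d, not only over its
      -- intersection with the solution set.
      p-equivariant : ∀ y → p y ∈ X → p (κ • y) ≈ᵛ π • p y
      A⁼-invariant  : ϱ⁼ • map (κ •_) A⁼ ≈ᴹ A⁼
      b⁼-invariant  : ϱ⁼ • b⁼ ≈ᵛ b⁼
      A≤-invariant  : ϱ≤ • map (κ •_) A≤ ≈ᴹ A≤
      b≤-invariant  : ϱ≤ • b≤ ≈ᵛ b≤

  IsSymmetric : ∀ {m r x g} {P : Pred (ℝ^ m) r} → Pred (Permutation′ m) g →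
                Pred (ℝ^ m) x → ExtendedFormulation P → Set (c ⊔ ℓ₁ ⊔ x ⊔ g)
  IsSymmetric G X E = ∀ π → π ∈ G → Invariance X E π

  -- Fin n is {0,…,n-1}, so the value ζ⁻¹(v) ∈ {1,…,n} is suc (toℕ _).
  permutahedronVertex : ∀ {n} → Permutation′ n → ℝ^ n
  permutahedronVertex ζ v = ℕ.suc (toℕ (ζ ⟨$⟩ˡ v)) ×ℝ 1#

  PermutahedronVertices : ∀ n → Pred (ℝ^ n) ℓ₁
  PermutahedronVertices n x = ∃ λ (ζ : Permutation′ n) → x ≈ᵛ permutahedronVertex ζ

  Permutahedron : ∀ n → Pred (ℝ^ n) (c ⊔ ℓ₁ ⊔ ℓ₂)
  Permutahedron n = ConvexHull (PermutahedronVertices n)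

{-# OPTIONS --safe #-}
module Submission where

-- Let N be the number of inequalities.  For an inequality i let Zᵢ be the set of
-- those ζ ∈ Sₙ for which i is tight on the whole fibre of Q over the vertex ζ.
-- Symmetry makes {Zᵢ} closed under left translation, so the stabilizer of each
-- Zᵢ has index at most N.  For each w the facet x₁ + … + x_w ≥ w (w + 1) / 2
-- provides an i with Young subgroup S_w × S_{n-w} ⊆ Zᵢ but (w w+1) ∉ Zᵢ:
-- otherwise one could extrapolate from a point over the facet, away from a point
-- over (w w+1), without leaving Q.
-- If N is small, then Bochert's argument yields a three-cycle in the stabilizer,
-- and counting cosets shows that the stabilizer contains the alternating group
-- of all points but one, e.  Then e is w or w + 1, and the translates of Zᵢ are
-- indexed by the images of e.  Moreover w is determined by such a translate and
-- by which of the two cases holds.  Hence n (n - 1) ≤ 2 N.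

open import Defs
open import Algebra.Module.Morphism.Structures using (module ModuleMorphisms)
import Algebra.Properties.CommutativeMonoid.Sum
import Algebra.Properties.Ring
import Algebra.Properties.Semiring.Mult
import Algebra.Properties.Semiring.Sum
import Algebra.Solver.Ring.NaturalCoefficients.Default
open import Data.Bool.Base using (Bool; true; false; not; if_then_else_)
open import Data.Bool.Properties as Bool using (not-¬)
open import Data.Empty using (⊥; ⊥-elim)
open import Data.Fin.Base as Fin using (Fin; zero; suc; toℕ; punchIn; punchOut; inject₁; _↑ˡ_; _↑ʳ_)
open import Data.Fin.Patterns using (0F; 1F; 2F)
open import Data.Fin.Permutation as Perm using (Permutation′; _⟨$⟩ʳ_; _⟨$⟩ˡ_; _∘ₚ_; flip; transpose; inverseˡ; inverseʳ)
open import Data.Fin.Permutation.Transposition.List using (TranspositionList; eval; decompose; eval-decompose)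
open import Data.Fin.Properties as Fin using ()
open import Data.List.Base using ([]; _∷_)
import Data.Nat.Base as ℕ
open import Data.Nat.Base using (ℕ; zero; suc; z≤n; s≤s)
import Data.Nat.Properties as ℕ
open import Data.Nat.Solver using (module +-*-Solver)
open import Data.Product.Base using (∃; ∃₂; _×_; _,_; proj₁; proj₂)
open import Data.Sum.Base using (_⊎_; inj₁; inj₂; [_,_]′)
open import Data.Vec.Functional using (Vector; map; zipWith) renaming (_∷_ to _∷ᵛ_; [] to []ᵛ)
open import Function.Base using (_∘_; case_of_)
open import Function.Bundles using (_⇔_; mk⇔; Equivalence)
open import Function.Construct.Composition using (_⇔-∘_)
open import Function.Construct.Identity using (⇔-id)
open import Function.Construct.Symmetry using (⇔-sym)
open import Function.Definitions using (Injective)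
open import Level using (Level; _⊔_) renaming (suc to lsuc)
open import Relation.Binary.Bundles using (StrictPartialOrder)
open import Relation.Binary.Core using (Rel)
open import Relation.Binary.Definitions using (tri<; tri≈; tri>)
open import Relation.Binary.PropositionalEquality as ≡ using (_≡_; _≢_; cong; cong₂; subst; subst₂; ≢-sym)
import Relation.Binary.Reasoning.StrictPartialOrder
open import Relation.Binary.Structures using (IsEquivalence; IsStrictTotalOrder)
open import Relation.Nullary using (¬_; Dec; yes; no; does; contradiction)
open import Relation.Nullary.Decidable using (¬¬-excluded-middle; dec-true; dec-false; decidable-stable)
open import Relation.Nullary.Negation using (¬¬-map)
open import Relation.Unary using (U; _∈_)

open Algebra.Properties.CommutativeMonoid.Sum ℕ.+-0-commutativeMonoid using ()
  renaming (sum to ℕ-sum; sum-permute to ℕ-sum-permute; ∑-distrib-+ to ℕ-∑-distrib-+; sum-cong-≗ to ℕ-sum-cong-≗)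

-- The final count has a factor two to spare: it gives n (n - 1) ≤ 2 N, while the claim has the
-- constant 4. The slack is spent on the group theory, which needs both N < k! for k = n/2 rounded
-- up and 2 N < (n - 1) (n - 2). For n = 6 the first condition reads N < 6, and it is reached only
-- because two variables are counted along. Tightness quantifies over a fibre in a real space, so
-- there is no decision procedure for it. Subgroups are therefore present only as relations between
-- permutations, and existence claims only under a double negation, which the decidable inequality
-- between natural numbers finally absorbs. No subgroup is enumerated: each counting bound is an
-- injection from an explicit finite family into the set of inequalities, or into two copies of it.

module SymmetricGroup where

  open ≡ using (refl; sym; trans; module ≡-Reasoning)
  open import Data.Fin.Properties using (_≟_)
  open import Data.Nat.Base using (_+_; _*_; _≤_; _<_; _≤ᵇ_; _!)

  private variable
    n N : ℕ
    ℓ : Level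

  -- Transpositions, and the cosets of a subgroup.

  infixr 9 _⊙_
  -- `∘ₚ` applies its left factor first; here the right factor acts first, as for maps, so that
  -- translating is multiplying on the left.
  _⊙_ : Permutation′ n → Permutation′ n → Permutation′ n
  g ⊙ h = h ∘ₚ g

  permutation-injective : (g : Permutation′ n) → Injective _≡_ _≡_ (g ⟨$⟩ʳ_)
  permutation-injective g eq = trans (sym (inverseˡ g)) (trans (cong (g ⟨$⟩ˡ_) eq) (inverseˡ g))

  transpose-first : (x y : Fin n) → transpose x y ⟨$⟩ʳ x ≡ y
  transpose-first x y with x ≟ x
  ... | yes _  = refl
  ... | no x≢x = contradiction refl x≢x

  transpose-second : (x y : Fin n) → transpose x y ⟨$⟩ʳ y ≡ x
  transpose-second x y with y ≟ x
  ... | yes y≡x = y≡x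
  ... | no _ with y ≟ y
  ...   | yes _  = refl
  ...   | no y≢y = contradiction refl y≢y

  transpose-other : {x y z : Fin n} → z ≢ x → z ≢ y → transpose x y ⟨$⟩ʳ z ≡ z
  transpose-other {x = x} {y} {z} z≢x z≢y with z ≟ x
  ... | yes z≡x = contradiction z≡x z≢x
  ... | no _ with z ≟ y
  ...   | yes z≡y = contradiction z≡y z≢y
  ...   | no _    = refl

  data TransposeView {n} (x y : Fin n) : Fin n → Set where
    first  : TransposeView x y x
    second : TransposeView x y y
    other  : ∀ {z} → z ≢ x → z ≢ y → TransposeView x y z

  transposeView : (x y z : Fin n) → TransposeView x y z
  transposeView x y z with z ≟ x | z ≟ y
  ... | yes refl | _        = first
  ... | no _     | yes refl = second
  ... | no z≢x   | no z≢y   = other z≢x z≢y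

  transpose-sym : (x y : Fin n) → transpose x y Perm.≈ transpose y x
  transpose-sym x y z with transposeView x y z
  ... | first         = trans (transpose-first x y) (sym (transpose-second y x))
  ... | second        = trans (transpose-second x y) (sym (transpose-first y x))
  ... | other z≢x z≢y = trans (transpose-other z≢x z≢y) (sym (transpose-other z≢y z≢x))

  transpose-involutive : (x y : Fin n) → transpose x y ⊙ transpose x y Perm.≈ Perm.id
  transpose-involutive x y z =
    trans (cong (transpose x y ⟨$⟩ʳ_) (transpose-sym x y z)) (inverseʳ (transpose x y))

  transpose-self : (x : Fin n) → transpose x x Perm.≈ Perm.id
  transpose-self x z with transposeView x x z
  ... | first         = transpose-first x x
  ... | second        = transpose-first x x
  ... | other z≢x _   = transpose-other z≢x z≢x

  ⊙-transpose : (g : Permutation′ n) (x y : Fin n) →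
                g ⊙ transpose x y Perm.≈ transpose (g ⟨$⟩ʳ x) (g ⟨$⟩ʳ y) ⊙ g
  ⊙-transpose g x y z with transposeView x y z
  ... | first         = trans (cong (g ⟨$⟩ʳ_) (transpose-first x y)) (sym (transpose-first (g ⟨$⟩ʳ x) (g ⟨$⟩ʳ y)))
  ... | second        = trans (cong (g ⟨$⟩ʳ_) (transpose-second x y)) (sym (transpose-second (g ⟨$⟩ʳ x) (g ⟨$⟩ʳ y)))
  ... | other z≢x z≢y = trans (cong (g ⟨$⟩ʳ_) (transpose-other z≢x z≢y))
    (sym (transpose-other (z≢x ∘ permutation-injective g) (z≢y ∘ permutation-injective g)))

  transpose-conjugate : {x y z : Fin n} → z ≢ x → z ≢ y →
    transpose x z Perm.≈ transpose x y ⊙ transpose y z ⊙ transpose x y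
  transpose-conjugate {x = x} {y} {z} z≢x z≢y i = sym (begin
    (transpose x y ⊙ transpose y z) ⟨$⟩ʳ (transpose x y ⟨$⟩ʳ i)
      ≡⟨ ⊙-transpose (transpose x y) y z (transpose x y ⟨$⟩ʳ i) ⟩
    transpose (transpose x y ⟨$⟩ʳ y) (transpose x y ⟨$⟩ʳ z) ⟨$⟩ʳ ((transpose x y ⊙ transpose x y) ⟨$⟩ʳ i)
      ≡⟨ cong (transpose (transpose x y ⟨$⟩ʳ y) _ ⟨$⟩ʳ_) (transpose-involutive x y i) ⟩
    transpose (transpose x y ⟨$⟩ʳ y) (transpose x y ⟨$⟩ʳ z) ⟨$⟩ʳ i
      ≡⟨ cong₂ (λ p q → transpose p q ⟨$⟩ʳ i) (transpose-second x y) (transpose-other z≢x z≢y) ⟩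
    transpose x z ⟨$⟩ʳ i ∎)
    where open ≡-Reasoning

  -- For a subgroup H of Sₙ, the relation gH = hH; the subgroup is recovered as
  -- the set of all h with h ~ id.
  record LeftCongruence (n : ℕ) (ℓ : Level) : Set (lsuc ℓ) where
    infix 4 _~_
    field
      _~_           : Rel (Permutation′ n) ℓ
      isEquivalence : IsEquivalence _~_
      ≈⇒~           : ∀ {g h} → g Perm.≈ h → g ~ h
      ⊙-congˡ       : ∀ k {g h} → g ~ h → k ⊙ g ~ k ⊙ h

    open IsEquivalence isEquivalence public
      renaming (refl to ~-refl; sym to ~-sym; trans to ~-trans)

    infixr 4 _≈~_ _~≈_
    _≈~_ : ∀ {g h k} → g Perm.≈ h → h ~ k → g ~ k
    p ≈~ q = ~-trans (≈⇒~ p) q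

    _~≈_ : ∀ {g h k} → g ~ h → h Perm.≈ k → g ~ k
    p ~≈ q = ~-trans p (≈⇒~ q)

    ⊙-stabilizer : ∀ g {h} → h ~ Perm.id → g ⊙ h ~ g
    ⊙-stabilizer g h~id = ⊙-congˡ g h~id ~≈ λ _ → refl

    ~⇒stabilizer : ∀ {g h} → g ~ h → flip g ⊙ h ~ Perm.id
    ~⇒stabilizer {g} g~h = ~-sym ((λ _ → sym (inverseˡ g)) ≈~ ⊙-congˡ (flip g) g~h)

    transpose-~-sym : ∀ {x y g} → transpose x y ~ g → transpose y x ~ g
    transpose-~-sym {x} {y} p = transpose-sym y x ≈~ p

    -- For distinct x, y, z the congruence of transpose x y and transpose y z says
    -- that the subgroup contains a three-cycle on them.
    triangle : ∀ {x y z g} → z ≢ x → z ≢ y →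
               transpose x y ~ g → transpose y z ~ g → transpose x z ~ g
    triangle {x} {y} {z} {g} z≢x z≢y xy~g yz~g =
      transpose-conjugate z≢x z≢y ≈~
      ~-trans (⊙-stabilizer (transpose x y)
                (~-trans (⊙-congˡ (transpose y z) (~-trans xy~g (~-sym yz~g)))
                         (≈⇒~ (transpose-involutive y z))))
              xy~g

    -- A left congruence does not in general allow multiplication on the right, but in h (x y) = (hx
    -- hy) h the trailing h is absorbed once it lies in the subgroup.
    stabilizer-transpose : ∀ {h x y z w} → h ~ Perm.id → transpose x y ~ transpose z w →
      transpose (h ⟨$⟩ʳ x) (h ⟨$⟩ʳ y) ~ transpose (h ⟨$⟩ʳ z) (h ⟨$⟩ʳ w)
    stabilizer-transpose {h} {x} {y} {z} {w} h~id p =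
      ~-trans (~-sym (image x y)) (~-trans (⊙-congˡ h p) (image z w))
      where
      image : ∀ x y → h ⊙ transpose x y ~ transpose (h ⟨$⟩ʳ x) (h ⟨$⟩ʳ y)
      image x y = ⊙-transpose h x y ≈~ ⊙-stabilizer _ h~id

  -- Bochert's argument: a subgroup of small index contains a three-cycle.

  commutator-three-cycle : (x y : Permutation′ n) (γ : Fin n) →
    x ⟨$⟩ʳ γ ≢ γ → y ⟨$⟩ʳ γ ≢ γ → (∀ z → z ≢ γ → x ⟨$⟩ʳ z ≢ z → y ⟨$⟩ʳ z ≡ z) →
    x ⊙ y Perm.≈ (transpose γ (x ⟨$⟩ʳ γ) ⊙ transpose (x ⟨$⟩ʳ γ) (y ⟨$⟩ʳ γ)) ⊙ y ⊙ x
  commutator-three-cycle {n} x y γ xγ≢γ yγ≢γ meet z = go (z ≟ γ) (x ⟨$⟩ʳ z ≟ z) (y ⟨$⟩ʳ z ≟ z)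
    where
    X = x ⟨$⟩ʳ_
    Y = y ⟨$⟩ʳ_
    -- The cycle γ, xγ, yγ, which is the commutator of x and y with its inverses cleared. The
    -- supports meet in γ alone, so x fixes yγ and y fixes xγ.
    c = transpose γ (X γ) ⊙ transpose (X γ) (Y γ)
    meet′ : ∀ z → z ≢ γ → Y z ≢ z → X z ≡ z
    meet′ z z≢γ Yz≢z with X z ≟ z
    ... | yes e = e
    ... | no e  = contradiction (meet z z≢γ e) Yz≢z
    YX : Y (X γ) ≡ X γ
    YX = meet (X γ) xγ≢γ (xγ≢γ ∘ permutation-injective x)
    XY : X (Y γ) ≡ Y γ
    XY = meet′ (Y γ) yγ≢γ (yγ≢γ ∘ permutation-injective y)
    Xγ≢Yγ : X γ ≢ Y γ
    Xγ≢Yγ e = yγ≢γ (permutation-injective x (trans XY (sym e)))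
    c-γ : c ⟨$⟩ʳ γ ≡ X γ
    c-γ = trans (cong (transpose γ (X γ) ⟨$⟩ʳ_) (transpose-other (≢-sym xγ≢γ) (≢-sym yγ≢γ))) (transpose-first γ (X γ))
    c-X : c ⟨$⟩ʳ X γ ≡ Y γ
    c-X = trans (cong (transpose γ (X γ) ⟨$⟩ʳ_) (transpose-first (X γ) (Y γ))) (transpose-other yγ≢γ (≢-sym Xγ≢Yγ))
    c-Y : c ⟨$⟩ʳ Y γ ≡ γ
    c-Y = trans (cong (transpose γ (X γ) ⟨$⟩ʳ_) (transpose-second (X γ) (Y γ))) (transpose-second γ (X γ))
    c-other : ∀ {w} → w ≢ γ → w ≢ X γ → w ≢ Y γ → c ⟨$⟩ʳ w ≡ w
    c-other p q r = trans (cong (transpose γ (X γ) ⟨$⟩ʳ_) (transpose-other q r)) (transpose-other p q)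
    go : Dec (z ≡ γ) → Dec (X z ≡ z) → Dec (Y z ≡ z) → X (Y z) ≡ c ⟨$⟩ʳ (Y (X z))
    go (yes refl) _ _ = trans XY (sym (trans (cong (c ⟨$⟩ʳ_) YX) c-X))
    go (no z≢γ) (yes Xz) (yes Yz) =
      trans (trans (cong X Yz) Xz) (sym (trans (cong (c ⟨$⟩ʳ_) (trans (cong Y Xz) Yz))
        (c-other z≢γ (λ e → z≢γ (permutation-injective x (trans Xz e)))
                     (λ e → z≢γ (permutation-injective y (trans Yz e))))))
    go (no z≢γ) (no Xz≢z) _ with X z ≟ γ
    ... | yes Xz≡γ = trans (cong X (meet z z≢γ Xz≢z)) (trans Xz≡γ (sym (trans (cong (λ w → c ⟨$⟩ʳ Y w) Xz≡γ) c-Y)))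
    ... | no Xz≢γ  = trans (cong X (meet z z≢γ Xz≢z)) (sym (trans (cong (c ⟨$⟩ʳ_) (meet (X z) Xz≢γ XXz≢Xz))
        (c-other Xz≢γ (z≢γ ∘ permutation-injective x) (λ e → XXz≢Xz (trans (cong X e) (trans XY (sym e)))))))
      where
      XXz≢Xz : X (X z) ≢ X z
      XXz≢Xz = Xz≢z ∘ permutation-injective x
    go (no z≢γ) (yes Xz) (no Yz≢z) with Y z ≟ γ
    ... | yes Yz≡γ = trans (cong X Yz≡γ) (sym (trans (cong (λ w → c ⟨$⟩ʳ Y w) Xz) (trans (cong (c ⟨$⟩ʳ_) Yz≡γ) c-γ)))
    ... | no Yz≢γ  = trans (meet′ (Y z) Yz≢γ YYz≢Yz) (sym (trans (cong (λ w → c ⟨$⟩ʳ Y w) Xz)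
        (c-other Yz≢γ (λ e → YYz≢Yz (trans (cong Y e) (trans YX (sym e)))) (z≢γ ∘ permutation-injective y))))
      where
      YYz≢Yz : Y (Y z) ≢ Y z
      YYz≢Yz = Yz≢z ∘ permutation-injective y

  -- The k! permutations supported on the image of δ, numbered by factorial digits.
  symmetricFamily : ∀ {k} → (Fin k → Fin n) → Fin (k !) → Permutation′ n
  symmetricFamily {k = zero}  δ _ = Perm.id
  symmetricFamily {k = suc k} δ s = let j , r = Fin.remQuot {suc k} (k !) s in
    transpose (δ zero) (δ j) ⊙ symmetricFamily (δ ∘ suc) r

  symmetricFamily-support : ∀ {k} (δ : Fin k → Fin n) s x → (∀ j → δ j ≢ x) →
    symmetricFamily δ s ⟨$⟩ʳ x ≡ x
  symmetricFamily-support {k = zero}  δ s x x∉δ = refl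
  symmetricFamily-support {k = suc k} δ s x x∉δ =
    trans (cong (transpose (δ zero) _ ⟨$⟩ʳ_) (symmetricFamily-support (δ ∘ suc) _ x (x∉δ ∘ suc)))
          (transpose-other (≢-sym (x∉δ zero)) (≢-sym (x∉δ _)))

  remQuot-injective : ∀ {m} k {s s′ : Fin (m * k)} → Fin.remQuot {m} k s ≡ Fin.remQuot {m} k s′ → s ≡ s′
  remQuot-injective {m} k {s} {s′} eq =
    trans (sym (Fin.combine-remQuot {m} k s))
          (trans (cong (λ p → Fin.combine (proj₁ p) (proj₂ p)) eq) (Fin.combine-remQuot {m} k s′))

  -- The leading digit is read off from the image of `δ zero`, which the permutation built from the
  -- other digits fixes; cancelling the leading transposition leaves the recursive case.
  symmetricFamily-injective : ∀ {k} (δ : Fin k → Fin n) → Injective _≡_ _≡_ δ →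
    Injective _≡_ Perm._≈_ (symmetricFamily δ)
  symmetricFamily-injective {k = zero}  δ δ-inj {zero} {zero} eq = refl
  symmetricFamily-injective {k = suc k} δ δ-inj {s} {s′} eq =
    remQuot-injective {suc k} (k !) (cong₂ _,_ j≡j′ (symmetricFamily-injective (δ ∘ suc) (Fin.suc-injective ∘ δ-inj) λ x →
      permutation-injective (transpose (δ zero) (δ (j s)))
        (trans (eq x) (cong (λ i → transpose (δ zero) (δ i) ⟨$⟩ʳ (symmetricFamily (δ ∘ suc) (r s′) ⟨$⟩ʳ x)) (sym j≡j′)))))
    where
    j : Fin (suc k !) → Fin (suc k)
    j s = proj₁ (Fin.remQuot {suc k} (k !) s)
    r : Fin (suc k !) → Fin (k !)
    r s = proj₂ (Fin.remQuot {suc k} (k !) s)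
    δ0∉ : ∀ i → δ (suc i) ≢ δ zero
    δ0∉ i e with δ-inj e
    ... | ()
    at0 : ∀ s → symmetricFamily δ s ⟨$⟩ʳ δ zero ≡ δ (j s)
    at0 s = trans (cong (transpose (δ zero) _ ⟨$⟩ʳ_) (symmetricFamily-support (δ ∘ suc) (r s) (δ zero) δ0∉))
                  (transpose-first (δ zero) (δ (j s)))
    j≡j′ : j s ≡ j s′
    j≡j′ = δ-inj (trans (sym (at0 s)) (trans (eq (δ zero)) (at0 s′)))

  -- Each round takes one point of `δ` out of the ambient set by `punchOut`; what is found in the
  -- smaller set is brought back by `punchIn`.
  injection-avoiding : ∀ {k} m → m + k ≤ n → (δ : Fin k → Fin n) → Injective _≡_ _≡_ δ →
    ∃ λ (η : Fin m → Fin n) → Injective _≡_ _≡_ η × (∀ i j → δ i ≢ η j)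
  injection-avoiding {k = zero} m m≤n δ _ =
    (λ j → Fin.inject≤ j m≤n′) , Fin.inject≤-injective m≤n′ m≤n′ _ _ , λ ()
    where m≤n′ = subst (_≤ _) (ℕ.+-identityʳ m) m≤n
  injection-avoiding {n = zero} {k = suc k} m _ δ _ = contradiction (δ zero) λ ()
  injection-avoiding {n = suc n} {k = suc k} m m+k≤n δ δ-inj =
    punchIn p ∘ η , (η-inj ∘ Fin.punchIn-injective p _ _) , avoid
    where
    p = δ zero
    p≢ : ∀ i → p ≢ δ (suc i)
    p≢ i e with δ-inj e
    ... | ()
    rec = injection-avoiding m (ℕ.s≤s⁻¹ (subst (_≤ suc n) (ℕ.+-suc m k) m+k≤n)) (λ i → punchOut (p≢ i))
            (Fin.suc-injective ∘ δ-inj ∘ Fin.punchOut-injective (p≢ _) (p≢ _))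
    η = proj₁ rec
    η-inj = proj₁ (proj₂ rec)
    avoid : ∀ i j → δ i ≢ punchIn p (η j)
    avoid zero    j e = Fin.punchInᵢ≢i p (η j) (sym e)
    avoid (suc i) j e = proj₂ (proj₂ rec) i j
      (Fin.punchIn-injective p _ _ (trans (Fin.punchIn-punchOut (p≢ i)) e))

  module _ (L : LeftCongruence n ℓ) where
    open LeftCongruence L

    -- The subgroup meets the symmetric group on the image of `δ` trivially, so the permutations of
    -- that image lie in pairwise different cosets.
    Independent : ∀ {k} → (Fin k → Fin n) → Set ℓ
    Independent δ = ∀ h → h ~ Perm.id → (∀ x → (∀ j → δ j ≢ x) → h ⟨$⟩ʳ x ≡ x) → h Perm.≈ Perm.id

    ThreeCycleFree : Set ℓ
    ThreeCycleFree = ∀ a b c → b ≢ a → c ≢ a → c ≢ b → ¬ transpose a b ~ transpose b c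

    -- Bochert's argument: two elements of the stabilizer whose supports meet
    -- in the single point γ have a three-cycle as commutator.
    independent-extend : ThreeCycleFree → ∀ {k} (δ : Fin k → Fin n) → Independent δ →
      ∀ x → x ~ Perm.id → (∀ j → x ⟨$⟩ʳ δ j ≡ δ j) → ∀ γ → x ⟨$⟩ʳ γ ≢ γ → Independent (γ ∷ᵛ δ)
    independent-extend free δ indep x x~id x-fixes γ xγ≢γ y y~id y-support with y ⟨$⟩ʳ γ ≟ γ
    ... | yes yγ≡γ = indep y y~id λ z z∉δ → helper z z∉δ (z ≟ γ)
      where
      helper : ∀ z → (∀ j → δ j ≢ z) → Dec (z ≡ γ) → y ⟨$⟩ʳ z ≡ z
      helper z z∉δ (yes refl) = yγ≡γ
      helper z z∉δ (no z≢γ)   = y-support z λ { zero → ≢-sym z≢γ ; (suc j) → z∉δ j }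
    ... | no yγ≢γ = contradiction three-cycle
                      (free γ (X γ) (Y γ) xγ≢γ yγ≢γ (λ e → yγ≢γ (permutation-injective x (trans XY e))))
      where
      X = x ⟨$⟩ʳ_
      Y = y ⟨$⟩ʳ_
      -- x fixes `δ` pointwise and y is supported on `γ ∷ᵛ δ`, so γ is the only point that both can
      -- move.
      meet : ∀ z → z ≢ γ → X z ≢ z → Y z ≡ z
      meet z z≢γ Xz≢z = y-support z λ { zero → ≢-sym z≢γ ; (suc j) refl → Xz≢z (x-fixes j) }
      XY : X (Y γ) ≡ Y γ
      XY with X (Y γ) ≟ Y γ
      ... | yes e = e
      ... | no e  = contradiction (permutation-injective y (meet (Y γ) yγ≢γ e)) yγ≢γ
      c = transpose γ (X γ) ⊙ transpose (X γ) (Y γ)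
      yx~id : y ⊙ x ~ Perm.id
      yx~id = ~-trans (⊙-stabilizer y x~id) y~id
      c~id : c ~ Perm.id
      c~id = ~-trans (~-sym (⊙-stabilizer c yx~id))
               (~-trans (~-sym (≈⇒~ (commutator-three-cycle x y γ xγ≢γ yγ≢γ meet)))
                        (~-trans (⊙-stabilizer x y~id) x~id))
      three-cycle : transpose γ (X γ) ~ transpose (X γ) (Y γ)
      three-cycle = ~-trans (~-sym (⊙-stabilizer (transpose γ (X γ)) c~id))
        (≈⇒~ λ i → transpose-involutive γ (X γ) (transpose (X γ) (Y γ) ⟨$⟩ʳ i))

    module _ (ι : Permutation′ n → Fin N) (ι-reflects : ∀ {g h} → ι g ≡ ι h → g ~ h) where

      independent⇒!≤ : ∀ {k} (δ : Fin k → Fin n) → Injective _≡_ _≡_ δ → Independent δ → k ! ≤ N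
      independent⇒!≤ δ δ-inj indep = Fin.injective⇒≤ {f = ι ∘ symmetricFamily δ} λ {s} {s′} eq →
        symmetricFamily-injective δ δ-inj λ x →
        let g = symmetricFamily δ s ; g′ = symmetricFamily δ s′ in
        trans (cong (g ⟨$⟩ʳ_) (sym (indep (flip g ⊙ g′) (~⇒stabilizer (ι-reflects eq)) (λ y y∉δ →
          trans (cong (g ⟨$⟩ˡ_) (symmetricFamily-support δ s′ y y∉δ))
            (trans (cong (g ⟨$⟩ˡ_) (sym (symmetricFamily-support δ s y y∉δ))) (inverseˡ g))) x)))
          (inverseʳ g)

      -- An independent set grows point by point. As k < m and 2 m ≤ n + 1, there is room for m
      -- points `η` off `δ`. They cannot be independent because N < m!, so some stabilizer element
      -- supported on `η` moves a point γ; it fixes `δ` pointwise, and γ joins `δ`.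
      threeCycleFree⇒independent : ThreeCycleFree → ∀ m → m + m ≤ suc n → N < m ! → ∀ k → k ≤ m →
        ¬ ¬ ∃ λ (δ : Fin k → Fin n) → Injective _≡_ _≡_ δ × Independent δ
      threeCycleFree⇒independent free m 2m≤1+n N<m! zero k≤m none =
        none ((λ ()) , (λ { {()} }) , λ h _ support x → support x λ ())
      threeCycleFree⇒independent free m 2m≤1+n N<m! (suc k) k<m none =
        threeCycleFree⇒independent free m 2m≤1+n N<m! k (ℕ.<⇒≤ k<m) λ (δ , δ-inj , δ-indep) →
        let η , η-inj , δ≢η = injection-avoiding m (ℕ.s≤s⁻¹ (ℕ.≤-trans
                                (ℕ.≤-reflexive (sym (ℕ.+-suc m k))) (ℕ.≤-trans (ℕ.+-monoʳ-≤ m k<m) 2m≤1+n))) δ δ-inj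
            η-indep : Independent η
            η-indep h h~id support γ = extend δ δ-inj δ-indep η δ≢η h h~id support γ (h ⟨$⟩ʳ γ ≟ γ)
        in ℕ.<⇒≱ N<m! (independent⇒!≤ η η-inj η-indep)
        where
        extend : (δ : Fin k → Fin n) → Injective _≡_ _≡_ δ → Independent δ →
                 (η : Fin m → Fin n) → (∀ i j → δ i ≢ η j) →
                 ∀ h → h ~ Perm.id → (∀ x → (∀ j → η j ≢ x) → h ⟨$⟩ʳ x ≡ x) →
                 ∀ γ → Dec (h ⟨$⟩ʳ γ ≡ γ) → h ⟨$⟩ʳ γ ≡ γ
        extend δ δ-inj δ-indep η δ≢η h h~id support γ (yes e) = e
        extend δ δ-inj δ-indep η δ≢η h h~id support γ (no hγ≢γ) = ⊥-elim
          (none (γ ∷ᵛ δ , γ∷δ-inj , independent-extend free δ δ-indep h h~id fixes γ hγ≢γ))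
          where
          fixes : ∀ j → h ⟨$⟩ʳ δ j ≡ δ j
          fixes j = support (δ j) λ i e → δ≢η j i (sym e)
          δ≢γ : ∀ j → δ j ≢ γ
          δ≢γ j refl = hγ≢γ (fixes j)
          γ∷δ-inj : Injective _≡_ _≡_ (γ ∷ᵛ δ)
          γ∷δ-inj {zero}  {zero}  e = refl
          γ∷δ-inj {zero}  {suc j} e = contradiction (sym e) (δ≢γ j)
          γ∷δ-inj {suc i} {zero}  e = contradiction e (δ≢γ i)
          γ∷δ-inj {suc i} {suc j} e = cong suc (δ-inj e)

      ¬threeCycleFree : ∀ m → m + m ≤ suc n → N < m ! → ¬ ThreeCycleFree
      ¬threeCycleFree m 2m≤1+n N<m! free = threeCycleFree⇒independent free m 2m≤1+n N<m! m ℕ.≤-refl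
        λ (δ , δ-inj , indep) → ℕ.<⇒≱ N<m! (independent⇒!≤ δ δ-inj indep)

  -- Finiteness lets the double negation move past the quantifier. Membership in a set without
  -- decision procedure may thus be assumed decided at all points at once.
  ¬¬-∀ : {P : Fin n → Set ℓ} → (∀ i → ¬ ¬ P i) → ¬ ¬ (∀ i → P i)
  ¬¬-∀ {n = zero}  ¬¬P ¬all = ¬all λ ()
  ¬¬-∀ {n = suc n} ¬¬P ¬all = ¬¬P zero λ p₀ → ¬¬-∀ (¬¬P ∘ suc) λ ps →
    ¬all λ { zero → p₀ ; (suc i) → ps i }

  -- Encoding pairs of points by symmetric differences.

  SamePair : (x y x′ y′ : Fin n) → Set
  SamePair x y x′ y′ = (x ≡ x′ × y ≡ y′) ⊎ (x ≡ y′ × y ≡ x′)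

  samePair : {x y x′ y′ : Fin n} → x ≢ y → (x ≡ x′ ⊎ x ≡ y′) → (y ≡ x′ ⊎ y ≡ y′) → SamePair x y x′ y′
  samePair x≢y (inj₁ p) (inj₁ q) = contradiction (trans p (sym q)) x≢y
  samePair x≢y (inj₁ p) (inj₂ q) = inj₁ (p , q)
  samePair x≢y (inj₂ p) (inj₁ q) = inj₂ (p , q)
  samePair x≢y (inj₂ p) (inj₂ q) = contradiction (trans p (sym q)) x≢y

  samePair-sym : {x y x′ y′ : Fin n} → SamePair x y x′ y′ → SamePair x′ y′ x y
  samePair-sym (inj₁ (p , q)) = inj₁ (sym p , sym q)
  samePair-sym (inj₂ (p , q)) = inj₂ (sym q , sym p)

  samePair? : (x y x′ y′ : Fin n) → Dec (SamePair x y x′ y′)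
  samePair? x y x′ y′ with x ≟ x′ | y ≟ y′ | x ≟ y′ | y ≟ x′
  ... | yes p | yes q | _     | _     = yes (inj₁ (p , q))
  ... | _     | _     | yes p | yes q = yes (inj₂ (p , q))
  ... | no ¬p | _     | no ¬q | _     = no [ ¬p ∘ proj₁ , ¬q ∘ proj₁ ]′
  ... | no ¬p | _     | _     | no ¬q = no [ ¬p ∘ proj₁ , ¬q ∘ proj₂ ]′
  ... | _     | no ¬p | no ¬q | _     = no [ ¬p ∘ proj₂ , ¬q ∘ proj₁ ]′
  ... | _     | no ¬p | _     | no ¬q = no [ ¬p ∘ proj₂ , ¬q ∘ proj₂ ]′

  module _ (χ : Fin n → Bool) where

    -- With C the set χ⁻¹(true), S is the symmetric difference of C and its preimage under f.
    record Flips (f : Permutation′ n) (S : Fin n → Set) : Set where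
      field
        on  : ∀ z → S z → χ (f ⟨$⟩ʳ z) ≡ not (χ z)
        off : ∀ z → ¬ S z → χ (f ⟨$⟩ʳ z) ≡ χ z

    flips-⊆ : ∀ {f f′ S S′} → Flips f S → Flips f′ S′ →
              (∀ z → χ (f ⟨$⟩ʳ z) ≡ χ (f′ ⟨$⟩ʳ z)) → ∀ z → S z → ¬ ¬ S′ z
    flips-⊆ F F′ eq z s ¬s′ = not-¬ refl (trans (sym (Flips.off F′ z ¬s′)) (trans (sym (eq z)) (Flips.on F z s)))

    Two : (x y z : Fin n) → Set
    Two x y z = z ≡ x ⊎ z ≡ y

    flips-id : Flips Perm.id (λ _ → ⊥)
    flips-id = record { on = λ _ () ; off = λ _ _ → refl }

    flips-transpose : ∀ {x y} → χ x ≡ not (χ y) → Flips (transpose x y) (Two x y)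
    flips-transpose {x} {y} χx = record
      { on  = λ { z (inj₁ refl) → trans (cong χ (transpose-first x y)) (sym (trans (cong not χx) (Bool.not-involutive _)))
                ; z (inj₂ refl) → trans (cong χ (transpose-second x y)) χx }
      ; off = λ z z∉ → cong χ (transpose-other (z∉ ∘ inj₁) (z∉ ∘ inj₂)) }

    flips-⊙ : ∀ {f g S T} → Flips f S → Flips g T → (∀ z → T z → ¬ S (g ⟨$⟩ʳ z)) →
              (∀ z → ¬ T z → g ⟨$⟩ʳ z ≡ z) → (∀ z → S z → ¬ T z) →
              Flips (f ⊙ g) (λ z → S z ⊎ T z)
    flips-⊙ {f} {g} F G away fixes disjoint = record
      { on  = λ { z (inj₁ s) → trans (cong (λ w → χ (f ⟨$⟩ʳ w)) (fixes z (disjoint z s))) (Flips.on F z s)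
                ; z (inj₂ t) → trans (Flips.off F _ (away z t)) (Flips.on G z t) }
      ; off = λ z z∉ → trans (cong (λ w → χ (f ⟨$⟩ʳ w)) (fixes z (z∉ ∘ inj₂))) (Flips.off F z (z∉ ∘ inj₁)) }

    separated : ∀ {x y} → χ x ≡ true → χ y ≡ false → x ≢ y
    separated χx χy refl with trans (sym χx) χy
    ... | ()

    flips-double : ∀ {x y u v} → x ≢ y → u ≢ v → χ x ≡ true → χ y ≡ true → χ u ≡ false → χ v ≡ false →
                   Flips (transpose x u ⊙ transpose y v) (λ z → Two x u z ⊎ Two y v z)
    flips-double {x} {y} {u} {v} x≢y u≢v χx χy χu χv =
      flips-⊙ (flips-transpose (trans χx (cong not (sym χu)))) (flips-transpose (trans χy (cong not (sym χv))))
        (λ { z (inj₁ refl) → apart v (transpose-first y v) (inj₂ refl)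
           ; z (inj₂ refl) → apart y (transpose-second y v) (inj₁ refl) })
        (λ z z∉ → transpose-other (z∉ ∘ inj₁) (z∉ ∘ inj₂))
        (λ z s t → disjoint z t s)
      where
      disjoint : ∀ z → Two y v z → ¬ Two x u z
      disjoint z (inj₁ refl) (inj₁ e) = x≢y (sym e)
      disjoint z (inj₁ refl) (inj₂ e) = separated χy χu e
      disjoint z (inj₂ refl) (inj₁ e) = separated χx χv (sym e)
      disjoint z (inj₂ refl) (inj₂ e) = u≢v (sym e)
      apart : ∀ w {w′} → w′ ≡ w → Two y v w → ¬ Two x u w′
      apart w refl = disjoint w

    -- The pair {x , y} is encoded by a permutation moving the set C = χ⁻¹(true)
    -- as little as possible: if C separates x and y it is replaced by its
    -- symmetric difference with {x , y}; otherwise two points of the other side,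
    -- u , v outside or a , b inside C, compensate for the change of size.
    module PairFamily {a b u v : Fin n} (a≢b : a ≢ b) (u≢v : u ≢ v) (χa : χ a ≡ true) (χb : χ b ≡ true)
                      (χu : χ u ≡ false) (χv : χ v ≡ false) where

      data View (x y : Fin n) : Permutation′ n → Set where
        cross   : χ x ≡ not (χ y) → View x y (transpose x y)
        inside  : χ x ≡ true → χ y ≡ true → View x y (transpose x u ⊙ transpose y v)
        outside : χ x ≡ false → χ y ≡ false → ¬ SamePair u v x y → View x y (transpose a x ⊙ transpose b y)
        -- Treated as an outside pair, {u , v} would get the support {a , b , u , v}, which already
        -- belongs to the inside pair {a , b}.
        base    : SamePair u v x y → View x y Perm.id

      view : ∀ x y → ∃ (View x y)
      view x y with χ x in χx | χ y in χy
      ... | true  | false = _ , cross (trans χx (cong not (sym χy)))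
      ... | false | true  = _ , cross (trans χx (cong not (sym χy)))
      ... | true  | true  = _ , inside χx χy
      ... | false | false with samePair? u v x y
      ...   | yes p = _ , base p
      ...   | no ¬p = _ , outside χx χy ¬p

      support : ∀ {x y f} → View x y f → Fin n → Set
      support {x} {y} (cross _)       = Two x y
      support {x} {y} (inside _ _)    = λ z → Two x u z ⊎ Two y v z
      support {x} {y} (outside _ _ _) = λ z → Two a x z ⊎ Two b y z
      support         (base _)        = λ _ → ⊥

      view-flips : ∀ {x y f} → x ≢ y → (V : View x y f) → Flips f (support V)
      view-flips x≢y (cross χx)         = flips-transpose χx
      view-flips x≢y (inside χx χy)     = flips-double x≢y u≢v χx χy χu χv
      view-flips x≢y (outside χx χy _)  = flips-double a≢b x≢y χa χb χx χy
      view-flips x≢y (base _)           = flips-id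

      -- A `cross` support is the pair itself, an `inside` support meets C in the pair, and an
      -- `outside` support meets the complement of C in it. A coincidence of the last two kinds
      -- would force the outside pair to be {u , v}, which `base` has taken out.
      recover : ∀ {x y x′ y′ f f′} → x ≢ y → x′ ≢ y′ → (V : View x y f) (V′ : View x′ y′ f′) →
                (∀ z → support V z → ¬ ¬ support V′ z) → (∀ z → support V′ z → ¬ ¬ support V z) →
                ¬ ¬ SamePair x y x′ y′
      recover {x} {y} {x′} {y′} x≢y x′≢y′ V V′ ⊆ ⊇ k = go V V′ ⊆ ⊇
        where
        same : ∀ {x y x′ y′ : Fin n} → x ≢ y → ¬ ¬ Two x′ y′ x → ¬ ¬ Two x′ y′ y → ¬ ¬ SamePair x y x′ y′
        same x≢y p q k = p λ p → q λ q → k (samePair x≢y p q)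
        upper : ∀ {x y u v z : Fin n} → χ u ≡ false → χ v ≡ false → χ z ≡ true → Two x u z ⊎ Two y v z → Two x y z
        upper χu χv χz (inj₁ (inj₁ e))    = inj₁ e
        upper χu χv χz (inj₁ (inj₂ refl)) = contradiction refl (separated χz χu)
        upper χu χv χz (inj₂ (inj₁ e))    = inj₂ e
        upper χu χv χz (inj₂ (inj₂ refl)) = contradiction refl (separated χz χv)
        lower : ∀ {x y u v z : Fin n} → χ x ≡ true → χ y ≡ true → χ z ≡ false → Two x u z ⊎ Two y v z → Two u v z
        lower χx χy χz (inj₁ (inj₂ e))    = inj₁ e
        lower χx χy χz (inj₁ (inj₁ refl)) = contradiction refl (separated χx χz)
        lower χx χy χz (inj₂ (inj₂ e))    = inj₂ e
        lower χx χy χz (inj₂ (inj₁ refl)) = contradiction refl (separated χy χz)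
        go : ∀ {f f′} (V : View x y f) (V′ : View x′ y′ f′) →
             (∀ z → support V z → ¬ ¬ support V′ z) → (∀ z → support V′ z → ¬ ¬ support V z) → ⊥
        go (base p) (base p′) _ _ = pairs p p′
          where
          pairs : SamePair u v x y → SamePair u v x′ y′ → ⊥
          pairs (inj₁ (refl , refl)) p′ = k p′
          pairs (inj₂ (refl , refl)) (inj₁ (refl , refl)) = k (inj₂ (refl , refl))
          pairs (inj₂ (refl , refl)) (inj₂ (refl , refl)) = k (inj₁ (refl , refl))
        go (cross _) (cross _) ⊆ ⊇ = same x≢y (⊆ x (inj₁ refl)) (⊆ y (inj₂ refl)) k
        go (cross _) (inside _ _) ⊆ ⊇ =
          same x′≢y′ (⊇ x′ (inj₁ (inj₁ refl))) (⊇ y′ (inj₂ (inj₁ refl))) (k ∘ samePair-sym)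
        go (cross _) (outside _ _ _) ⊆ ⊇ =
          same x′≢y′ (⊇ x′ (inj₁ (inj₂ refl))) (⊇ y′ (inj₂ (inj₂ refl))) (k ∘ samePair-sym)
        go (inside _ _) (cross _) ⊆ ⊇ = same x≢y (⊆ x (inj₁ (inj₁ refl))) (⊆ y (inj₂ (inj₁ refl))) k
        go (outside _ _ _) (cross _) ⊆ ⊇ = same x≢y (⊆ x (inj₁ (inj₂ refl))) (⊆ y (inj₂ (inj₂ refl))) k
        go (inside χx χy) (inside _ _) ⊆ ⊇ =
          same x≢y (¬¬-map (upper χu χv χx) (⊆ x (inj₁ (inj₁ refl)))) (¬¬-map (upper χu χv χy) (⊆ y (inj₂ (inj₁ refl)))) k
        go (outside χx χy _) (outside _ _ _) ⊆ ⊇ =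
          same x≢y (¬¬-map (lower χa χb χx) (⊆ x (inj₁ (inj₂ refl)))) (¬¬-map (lower χa χb χy) (⊆ y (inj₂ (inj₂ refl)))) k
        go (inside _ _) (outside _ _ new) ⊆ ⊇ =
          same u≢v (¬¬-map (lower χa χb χu) (⊆ u (inj₁ (inj₂ refl)))) (¬¬-map (lower χa χb χv) (⊆ v (inj₂ (inj₂ refl)))) new
        go (outside _ _ new) (inside _ _) ⊆ ⊇ =
          same u≢v (¬¬-map (lower χa χb χu) (⊇ u (inj₁ (inj₂ refl)))) (¬¬-map (lower χa χb χv) (⊇ v (inj₂ (inj₂ refl)))) new
        go (base _) (cross _) ⊆ ⊇ = ⊇ x′ (inj₁ refl) λ ()
        go (base _) (inside _ _) ⊆ ⊇ = ⊇ x′ (inj₁ (inj₁ refl)) λ ()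
        go (base _) (outside _ _ _) ⊆ ⊇ = ⊇ x′ (inj₁ (inj₂ refl)) λ ()
        go (cross _) (base _) ⊆ ⊇ = ⊆ x (inj₁ refl) λ ()
        go (inside _ _) (base _) ⊆ ⊇ = ⊆ x (inj₁ (inj₁ refl)) λ ()
        go (outside _ _ _) (base _) ⊆ ⊇ = ⊆ x (inj₁ (inj₂ refl)) λ ()

      -- Applied to the third point of the three-cycle: pairs are chosen off it, since
      -- `stabilizer-C` requires it to stay put.
      view-fixes : ∀ {x y f c} → (V : View x y f) → χ c ≡ true → c ≢ a → c ≢ b → c ≢ x → c ≢ y → f ⟨$⟩ʳ c ≡ c
      view-fixes (cross _) χc c≢a c≢b c≢x c≢y = transpose-other c≢x c≢y
      view-fixes {x} (inside _ _) χc c≢a c≢b c≢x c≢y =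
        trans (cong (transpose x u ⟨$⟩ʳ_) (transpose-other c≢y (separated χc χv))) (transpose-other c≢x (separated χc χu))
      view-fixes {x} (outside _ _ _) χc c≢a c≢b c≢x c≢y =
        trans (cong (transpose a x ⟨$⟩ʳ_) (transpose-other c≢b c≢y)) (transpose-other c≢a c≢x)
      view-fixes (base _) _ _ _ _ _ = refl

  -- Ordered pairs are easier to number than unordered ones: two nested `punchIn`s enumerate those
  -- off c, and the bit `order` tells (x , y) from (y , x), at the price of doubling N.
  orderedPair-bound : ∀ {m} (c : Fin (suc (suc m))) (κ : Fin (suc (suc m)) → Fin (suc (suc m)) → Fin N) →
    (∀ {x y x′ y′} → x ≢ y → x′ ≢ y′ → c ≢ x → c ≢ y → c ≢ x′ → c ≢ y′ → κ x y ≡ κ x′ y′ → SamePair x y x′ y′) →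
    suc m * m ≤ N * 2
  orderedPair-bound {N = N} {m} c κ κ-inj = Fin.injective⇒≤ {f = code} code-injective
    where
    fst snd : Fin (suc m * m) → Fin (suc (suc m))
    fst s = punchIn c (proj₁ (Fin.remQuot {suc m} m s))
    snd s = punchIn c (punchIn (proj₁ (Fin.remQuot {suc m} m s)) (proj₂ (Fin.remQuot {suc m} m s)))
    c≢fst : ∀ s → c ≢ fst s
    c≢fst s e = Fin.punchInᵢ≢i c _ (sym e)
    c≢snd : ∀ s → c ≢ snd s
    c≢snd s e = Fin.punchInᵢ≢i c _ (sym e)
    fst≢snd : ∀ s → fst s ≢ snd s
    fst≢snd s e = Fin.punchInᵢ≢i _ _ (sym (Fin.punchIn-injective c _ _ e))
    order : Fin (suc m * m) → Fin 2
    order s with toℕ (fst s) ℕ.<? toℕ (snd s)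
    ... | yes _ = zero
    ... | no _  = suc zero
    code : Fin (suc m * m) → Fin (N * 2)
    code s = Fin.combine (κ (fst s) (snd s)) (order s)
    same-coordinates : ∀ {s s′} → fst s ≡ fst s′ → snd s ≡ snd s′ → s ≡ s′
    same-coordinates {s} {s′} p q = remQuot-injective {suc m} m (pairs (Fin.remQuot {suc m} m s) (Fin.remQuot {suc m} m s′) p q)
      where
      pairs : ∀ (r r′ : Fin (suc m) × Fin m) → punchIn c (proj₁ r) ≡ punchIn c (proj₁ r′) →
              punchIn c (punchIn (proj₁ r) (proj₂ r)) ≡ punchIn c (punchIn (proj₁ r′) (proj₂ r′)) → r ≡ r′
      pairs (i , j) (i′ , j′) p q with Fin.punchIn-injective c _ _ p
      ... | refl with Fin.punchIn-injective i _ _ (Fin.punchIn-injective c _ _ q)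
      ... | refl = refl
    order-flips : ∀ s s′ → fst s ≡ snd s′ → snd s ≡ fst s′ → order s ≢ order s′
    order-flips s s′ p q with toℕ (fst s) ℕ.<? toℕ (snd s) | toℕ (fst s′) ℕ.<? toℕ (snd s′)
    ... | yes l | yes l′ = λ _ → ℕ.<-asym l (subst₂ (λ x y → toℕ x < toℕ y) (sym q) (sym p) l′)
    ... | yes _ | no _ = λ ()
    ... | no _ | yes _ = λ ()
    ... | no l | no l′ = λ _ → l (ℕ.≤∧≢⇒< (ℕ.≮⇒≥ (λ gt → l′ (subst₂ (λ x y → toℕ x < toℕ y) q p gt))) (fst≢snd s ∘ Fin.toℕ-injective))
    code-injective : Injective _≡_ _≡_ code
    code-injective {s} {s′} eq with Fin.combine-injective (κ (fst s) (snd s)) (order s) (κ (fst s′) (snd s′)) (order s′) eq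
    ... | κ≡ , order≡ with κ-inj (fst≢snd s) (fst≢snd s′) (c≢fst s) (c≢snd s) (c≢fst s′) (c≢snd s′) κ≡
    ...   | inj₁ (p , q) = same-coordinates p q
    ...   | inj₂ (p , q) = contradiction order≡ (order-flips s s′ p q)

  -- From a three-cycle to the alternating group on all points but one.

  module _ (L : LeftCongruence n ℓ) where
    open LeftCongruence L

    -- Products of two transpositions generate the alternating group on the points other than e;
    -- putting all these transpositions into one coset avoids any notion of sign.
    AlternatingOff : Fin n → Set ℓ
    AlternatingOff e = ∀ {x y z w} → x ≢ e → y ≢ e → z ≢ e → w ≢ e → x ≢ y → z ≢ w →
                       transpose x y ~ transpose z w

    module ThreeCycle {a b c : Fin n} (b≢a : b ≢ a) (c≢a : c ≢ a) (c≢b : c ≢ b)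
                      (abc : transpose a b ~ transpose b c) where

      -- The points that can be joined to the three-cycle: by `edge`, all transpositions within `C`
      -- share one coset, so the subgroup contains the alternating group of `C`. The point a is
      -- listed apart because `transpose a a` is the identity.
      C : Fin n → Set ℓ
      C z = z ≡ a ⊎ transpose a z ~ transpose a b

      a∈C : C a
      a∈C = inj₁ refl

      b∈C : C b
      b∈C = inj₂ ~-refl

      c∈C : C c
      c∈C = inj₂ (triangle c≢a c≢b ~-refl (~-sym abc))

      edge : ∀ {x y} → x ≢ y → C x → C y → transpose x y ~ transpose a b
      edge x≢y (inj₁ refl) (inj₁ refl) = contradiction refl x≢y
      edge x≢y (inj₁ refl) (inj₂ q)    = q
      edge x≢y (inj₂ p)    (inj₁ refl) = transpose-~-sym p
      edge {x} {y} x≢y (inj₂ p) (inj₂ q) with y ≟ a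
      ... | yes refl = transpose-~-sym p
      ... | no y≢a   = triangle (≢-sym x≢y) y≢a (transpose-~-sym p) q

      edge-closed : ∀ {x y} → y ≢ x → C x → transpose x y ~ transpose a b → C y
      edge-closed {x} {y} y≢x (inj₁ refl) p = inj₂ p
      edge-closed {x} {y} y≢x (inj₂ q) p with y ≟ a
      ... | yes y≡a = inj₁ y≡a
      ... | no y≢a  = inj₂ (triangle y≢a y≢x q p)

      alternatingOff : ∀ e → (∀ x → x ≢ e → C x) → AlternatingOff e
      alternatingOff e all x≢e y≢e z≢e w≢e x≢y z≢w =
        ~-trans (edge x≢y (all _ x≢e) (all _ y≢e)) (~-sym (edge z≢w (all _ z≢e) (all _ w≢e)))

      module _ (C? : ∀ z → Dec (C z)) where

        -- The subgroup also contains the alternating group of h(C). Since c lies in both sets,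
        -- three-cycles through c tie them together; without a common point h could move `C` to a
        -- disjoint set.
        stabilizer-C : ∀ {h} → h ~ Perm.id → h ⟨$⟩ʳ c ≡ c → ∀ {x} → C x → C (h ⟨$⟩ʳ x)
        stabilizer-C {h} h~id hc≡c {x} x∈C = go (x ≟ c) (x ≟ a)
          where
          H = h ⟨$⟩ʳ_
          H-inj = permutation-injective h
          -- (H x, H y, c) is a three-cycle in the stabilizer; if it leaves C, then
          -- conjugating (a b c) with it moves c out of C, too.
          step : ∀ {y} → x ≢ c → y ≢ c → x ≢ y → C y → C (H x)
          step {y} x≢c y≢c x≢y y∈C with C? (H x) | C? (H y)
          ... | yes Hx∈C | _ = Hx∈C
          ... | no Hx∉C | yes Hy∈C = contradiction (edge-closed (≢-sym c≢Hx) c∈C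
                  (transpose-~-sym (~-trans xc~cy (edge (≢-sym Hy≢c) c∈C Hy∈C)))) Hx∉C
            where
            c≢Hx : c ≢ H x
            c≢Hx e = x≢c (H-inj (trans (sym e) (sym hc≡c)))
            Hy≢c : H y ≢ c
            Hy≢c e = y≢c (H-inj (trans e (sym hc≡c)))
            xc~cy : transpose (H x) c ~ transpose c (H y)
            xc~cy = subst (λ w → transpose (H x) w ~ transpose w (H y)) hc≡c
                      (stabilizer-transpose h~id (~-trans (edge x≢c x∈C c∈C) (~-sym (edge (≢-sym y≢c) c∈C y∈C))))
          ... | no Hx∉C | no Hy∉C = contradiction (edge-closed (≢-sym (outside b∈C Hy∉C)) b∈C b-Hy) Hy∉C
            where
            outside : ∀ {z w} → C z → ¬ C w → z ≢ w
            outside z∈C w∉C refl = w∉C z∈C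
            xc~cy : transpose (H x) c ~ transpose c (H y)
            xc~cy = subst (λ w → transpose (H x) w ~ transpose w (H y)) hc≡c
                      (stabilizer-transpose h~id (~-trans (edge x≢c x∈C c∈C) (~-sym (edge (≢-sym y≢c) c∈C y∈C))))
            k = transpose (H x) c ⊙ transpose c (H y)
            k~id : k ~ Perm.id
            k~id = ~-trans (⊙-congˡ (transpose (H x) c) (~-sym xc~cy)) (≈⇒~ (transpose-involutive (H x) c))
            k-fixes : ∀ {z} → C z → z ≢ c → k ⟨$⟩ʳ z ≡ z
            k-fixes z∈C z≢c = trans (cong (transpose (H x) c ⟨$⟩ʳ_) (transpose-other z≢c (outside z∈C Hy∉C)))
                                    (transpose-other (outside z∈C Hx∉C) z≢c)
            kc : k ⟨$⟩ʳ c ≡ H y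
            kc = trans (cong (transpose (H x) c ⟨$⟩ʳ_) (transpose-first c (H y)))
                       (transpose-other (x≢y ∘ sym ∘ H-inj) (≢-sym (outside c∈C Hy∉C)))
            b-Hy : transpose b (H y) ~ transpose a b
            b-Hy = ~-sym (subst₂~ (k-fixes a∈C (≢-sym c≢a)) (k-fixes b∈C (≢-sym c≢b)) kc (stabilizer-transpose k~id abc))
              where
              subst₂~ : ∀ {a b c a′ b′ c′} → a ≡ a′ → b ≡ b′ → c ≡ c′ →
                        transpose a b ~ transpose b c → transpose a′ b′ ~ transpose b′ c′
              subst₂~ refl refl refl p = p
          go : Dec (x ≡ c) → Dec (x ≡ a) → C (H x)
          go (yes refl) _        = subst C (sym hc≡c) c∈C
          go (no x≢c) (yes refl) = step x≢c (≢-sym c≢b) (≢-sym b≢a) b∈C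
          go (no x≢c) (no x≢a)   = step x≢c (≢-sym c≢a) x≢a a∈C

        χ : Fin n → Bool
        χ z = does (C? z)

        -- The cosets are those of the inverses, so g f⁻¹ lies in the stabilizer. It fixes c, hence
        -- preserves `C`, and it takes f z to g z.
        C-transfer : ∀ {f g} → flip f ~ flip g → f ⟨$⟩ʳ c ≡ c → g ⟨$⟩ʳ c ≡ c →
                     ∀ z → C (f ⟨$⟩ʳ z) → C (g ⟨$⟩ʳ z)
        C-transfer {f} {g} f~g fc gc z p = subst (λ w → C (g ⟨$⟩ʳ w)) (inverseˡ f)
          (stabilizer-C (~⇒stabilizer (~-sym f~g))
            (trans (cong (g ⟨$⟩ʳ_) (trans (cong (f ⟨$⟩ˡ_) (sym fc)) (inverseˡ f))) gc) p)

        χ-~ : ∀ {f g} → flip f ~ flip g → f ⟨$⟩ʳ c ≡ c → g ⟨$⟩ʳ c ≡ c →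
              ∀ z → χ (f ⟨$⟩ʳ z) ≡ χ (g ⟨$⟩ʳ z)
        χ-~ {f} {g} f~g fc gc z with C? (f ⟨$⟩ʳ z) | C? (g ⟨$⟩ʳ z)
        ... | yes _ | yes _ = refl
        ... | no _  | no _  = refl
        ... | yes p | no ¬q = contradiction (C-transfer f~g fc gc z p) ¬q
        ... | no ¬p | yes q = contradiction (C-transfer (~-sym f~g) gc fc z q) ¬p

  module _ {m : ℕ} (L : LeftCongruence (suc (suc m)) ℓ) (ι : Permutation′ (suc (suc m)) → Fin N)
           (ι-reflects : ∀ {g h} → ι g ≡ ι h → LeftCongruence._~_ L g h) where
    open LeftCongruence L

    -- Two points outside `C` are what the encoding of pairs needs for its compensation. Equal
    -- cosets give equal preimages of `C`, hence equal supports, from which `recover` regains the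
    -- pair.
    pair-bound : ∀ {a b c} (b≢a : b ≢ a) (c≢a : c ≢ a) (c≢b : c ≢ b) (abc : transpose a b ~ transpose b c) →
      let open ThreeCycle L b≢a c≢a c≢b abc in
      (∀ z → Dec (C z)) → ∀ {u v} → u ≢ v → ¬ C u → ¬ C v → suc m * m ≤ N * 2
    pair-bound {a} {b} {c} b≢a c≢a c≢b abc C? {u} {v} u≢v u∉C v∉C =
      orderedPair-bound c (λ x y → ι (flip (proj₁ (view x y)))) injective
      where
      open ThreeCycle L b≢a c≢a c≢b abc
      open PairFamily (χ C?) (≢-sym b≢a) u≢v (dec-true (C? a) a∈C) (dec-true (C? b) b∈C)
                      (dec-false (C? u) u∉C) (dec-false (C? v) v∉C)
      injective : ∀ {x y x′ y′} → x ≢ y → x′ ≢ y′ → c ≢ x → c ≢ y → c ≢ x′ → c ≢ y′ →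
                  ι (flip (proj₁ (view x y))) ≡ ι (flip (proj₁ (view x′ y′))) → SamePair x y x′ y′
      injective {x} {y} {x′} {y′} x≢y x′≢y′ c≢x c≢y c≢x′ c≢y′ eq =
        decidable-stable (samePair? x y x′ y′) (recover x≢y x′≢y′ V V′
          (flips-⊆ (χ C?) (view-flips x≢y V) (view-flips x′≢y′ V′) χ≗)
          (flips-⊆ (χ C?) (view-flips x′≢y′ V′) (view-flips x≢y V) (sym ∘ χ≗)))
        where
        V = proj₂ (view x y)
        V′ = proj₂ (view x′ y′)
        χc = dec-true (C? c) c∈C
        χ≗ = χ-~ C? (ι-reflects eq) (view-fixes V χc c≢a c≢b c≢x c≢y) (view-fixes V′ χc c≢a c≢b c≢x′ c≢y′)

    smallIndex⇒alternatingOff : ∀ k → k + k ≤ suc (suc (suc m)) → N < k ! → N * 2 < suc m * m →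
                                ¬ ¬ ∃ λ e → AlternatingOff L e
    smallIndex⇒alternatingOff k 2k≤1+n N<k! 2N<m² none =
      ¬threeCycleFree L ι ι-reflects k 2k≤1+n N<k! λ a b c b≢a c≢a c≢b abc →
      let open ThreeCycle L b≢a c≢a c≢b abc in
      ¬¬-∀ (λ z → ¬¬-excluded-middle {A = C z}) λ C? →
      none (choose b≢a c≢a c≢b abc C?)
      where
      choose : ∀ {a b c} (b≢a : b ≢ a) (c≢a : c ≢ a) (c≢b : c ≢ b) (abc : transpose a b ~ transpose b c) →
               let open ThreeCycle L b≢a c≢a c≢b abc in (∀ z → Dec (C z)) → ∃ λ e → AlternatingOff L e
      choose b≢a c≢a c≢b abc C? with Fin.all? C?
      -- Nothing is missing from `C`, so any point can serve as e.
      ... | yes all = zero , ThreeCycle.alternatingOff L b≢a c≢a c≢b abc zero (λ x _ → all x)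
      ... | no ¬all with Fin.¬∀⟶∃¬ _ _ C? ¬all
      ...   | u , u∉C = u , ThreeCycle.alternatingOff L b≢a c≢a c≢b abc u λ x x≢u →
                decidable-stable (C? x) λ x∉C →
                ℕ.<⇒≱ 2N<m² (pair-bound b≢a c≢a c≢b abc C? x≢u x∉C u∉C)

  -- Cosets of a subgroup that contains the alternating group off a point.

  ≈-flip : {g h : Permutation′ n} → g Perm.≈ h → flip g Perm.≈ flip h
  ≈-flip {g = g} {h} g≈h z =
    trans (cong (g ⟨$⟩ˡ_) (trans (sym (inverseʳ h)) (sym (g≈h (h ⟨$⟩ˡ z))))) (inverseˡ g)

  module _ (L : LeftCongruence n ℓ) {e : Fin n} (off : AlternatingOff L e) where
    open LeftCongruence L

    module _ {k l : Fin n} (k≢l : k ≢ l) (k≢e : k ≢ e) (l≢e : l ≢ e) where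

      -- Modulo the subgroup, a product of transpositions off e depends only on its parity;
      -- `transpose k l` stands for the odd ones.
      IdOr : Permutation′ n → Set ℓ
      IdOr v = v ~ Perm.id ⊎ v ~ transpose k l

      idOr-resp : ∀ {v v′} → v Perm.≈ v′ → IdOr v′ → IdOr v
      idOr-resp v≈v′ (inj₁ p) = inj₁ (v≈v′ ≈~ p)
      idOr-resp v≈v′ (inj₂ p) = inj₂ (v≈v′ ≈~ p)

      idOr-transpose : ∀ {x y v} → x ≢ y → x ≢ e → y ≢ e → IdOr v → IdOr (transpose x y ⊙ v)
      idOr-transpose {x} {y} x≢y x≢e y≢e (inj₁ p) =
        inj₂ (~-trans (⊙-stabilizer (transpose x y) p) (off x≢e y≢e k≢e l≢e x≢y k≢l))
      idOr-transpose {x} {y} x≢y x≢e y≢e (inj₂ p) =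
        inj₁ (~-trans (⊙-congˡ (transpose x y) (~-trans p (off k≢e l≢e x≢e y≢e k≢l x≢y)))
                      (≈⇒~ (transpose-involutive x y)))

      -- For j = u e the product (e j) u fixes e and is thus a product of transpositions off e.
      -- Keeping j as a separate argument allows induction along a factorization of u.
      Sends : Fin n → Permutation′ n → Set ℓ
      Sends j u = IdOr (transpose e j ⊙ u)

      sends-star : ∀ {y} → y ≢ e → ∀ j u → Sends j u → Sends (transpose e y ⟨$⟩ʳ j) (transpose e y ⊙ u)
      sends-star {y} y≢e j u r with transposeView e y j
      ... | first  = idOr-resp (λ z → trans (cong (λ i → transpose e i ⟨$⟩ʳ (transpose e y ⟨$⟩ʳ (u ⟨$⟩ʳ z))) (transpose-first e y))
                       (trans (transpose-involutive e y (u ⟨$⟩ʳ z)) (sym (transpose-self e (u ⟨$⟩ʳ z))))) r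
      ... | second = idOr-resp (λ z → trans (cong (λ i → transpose e i ⟨$⟩ʳ (transpose e y ⟨$⟩ʳ (u ⟨$⟩ʳ z))) (transpose-second e y))
                       (transpose-self e (transpose e y ⟨$⟩ʳ (u ⟨$⟩ʳ z)))) r
      -- Here (e j) (e y) = (j y) (e j), and (j y) avoids e.
      ... | other j≢e j≢y = idOr-resp (λ z → trans (cong (λ i → transpose e i ⟨$⟩ʳ (transpose e y ⟨$⟩ʳ (u ⟨$⟩ʳ z))) (transpose-other j≢e j≢y))
                       (trans (⊙-transpose (transpose e j) e y (u ⟨$⟩ʳ z))
                         (cong₂ (λ p q → transpose p q ⟨$⟩ʳ (transpose e j ⟨$⟩ʳ (u ⟨$⟩ʳ z)))
                                (transpose-first e j) (transpose-other y≢e (≢-sym j≢y)))))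
                       (idOr-transpose j≢y j≢e y≢e r)

      sends-transpose : ∀ x y j u → Sends j u → Sends (transpose x y ⟨$⟩ʳ j) (transpose x y ⊙ u)
      sends-transpose x y j u r with x ≟ y
      ... | yes refl = idOr-resp
              (λ z → cong₂ (λ i j → transpose e i ⟨$⟩ʳ j) (transpose-self x j) (transpose-self x (u ⟨$⟩ʳ z))) r
      ... | no x≢y with x ≟ e | y ≟ e
      ...   | no x≢e | no y≢e = idOr-resp
              (λ z → sym (trans (⊙-transpose (transpose x y) e j (u ⟨$⟩ʳ z))
                     (cong (λ i → transpose i (transpose x y ⟨$⟩ʳ j) ⟨$⟩ʳ (transpose x y ⟨$⟩ʳ (u ⟨$⟩ʳ z)))
                           (transpose-other (≢-sym x≢e) (≢-sym y≢e)))))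
              (idOr-transpose x≢y x≢e y≢e r)
      ...   | yes refl | _ = sends-star (≢-sym x≢y) j u r
      ...   | no _ | yes refl = idOr-resp
              (λ z → cong₂ (λ i w → transpose e i ⟨$⟩ʳ w) (transpose-sym x e j) (transpose-sym x e (u ⟨$⟩ʳ z)))
              (sends-star x≢y j u r)

      -- `eval` lets the head of the list act first; in the inverse it acts last and becomes the
      -- left factor that `sends-transpose` handles.
      sends-eval : ∀ (ts : TranspositionList n) → Sends (flip (eval ts) ⟨$⟩ʳ e) (flip (eval ts))
      sends-eval []             = inj₁ (≈⇒~ (transpose-self e))
      sends-eval ((i , j) ∷ ts) = sends-transpose j i (flip (eval ts) ⟨$⟩ʳ e) (flip (eval ts)) (sends-eval ts)

      sends : ∀ u → Sends (u ⟨$⟩ʳ e) u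
      sends u = idOr-resp (λ z → sym (cong₂ (λ i j → transpose e i ⟨$⟩ʳ j) (eq e) (eq z))) (sends-eval (decompose (flip u)))
        where
        eq : flip (eval (decompose (flip u))) Perm.≈ u
        eq = ≈-flip {g = eval (decompose (flip u))} {h = flip u} (eval-decompose (flip u))

      two-cosets : ∀ u → u ~ transpose e (u ⟨$⟩ʳ e) ⊎ u ~ transpose e (u ⟨$⟩ʳ e) ⊙ transpose k l
      two-cosets u = [ (λ p → inj₁ (~-trans back (⊙-stabilizer t p))) , (λ p → inj₂ (~-trans back (⊙-congˡ t p))) ]′ (sends u)
        where
        t = transpose e (u ⟨$⟩ʳ e)
        back : u ~ t ⊙ (t ⊙ u)
        back = ≈⇒~ λ z → sym (transpose-involutive e (u ⟨$⟩ʳ e) (u ⟨$⟩ʳ z))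

    -- Every transposition except (e e′) avoids e or e′, and that one is linked to (k l) by a
    -- triangle through k. Four points provide k and l.
    alternatingOff-both : ∀ {e′} → 4 ≤ n → e ≢ e′ → AlternatingOff L e′ →
                          ∀ {x y z w} → x ≢ y → z ≢ w → transpose x y ~ transpose z w
    alternatingOff-both {e′} 4≤n e≢e′ off′ x≢y z≢w = ~-trans (reference x≢y) (~-sym (reference z≢w))
      where
      avoiding = injection-avoiding 2 4≤n (e ∷ᵛ e′ ∷ᵛ []ᵛ) λ
        { {0F} {0F} _ → refl ; {0F} {1F} eq → contradiction eq e≢e′
        ; {1F} {0F} eq → contradiction (sym eq) e≢e′ ; {1F} {1F} _ → refl }
      k = proj₁ avoiding 0F
      l = proj₁ avoiding 1F
      k≢l : k ≢ l
      k≢l eq with proj₁ (proj₂ avoiding) eq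
      ... | ()
      k≢e  = ≢-sym (proj₂ (proj₂ avoiding) 0F 0F)
      l≢e  = ≢-sym (proj₂ (proj₂ avoiding) 0F 1F)
      k≢e′ = ≢-sym (proj₂ (proj₂ avoiding) 1F 0F)
      l≢e′ = ≢-sym (proj₂ (proj₂ avoiding) 1F 1F)
      e-e′ : transpose e e′ ~ transpose k l
      e-e′ = triangle (≢-sym e≢e′) (≢-sym k≢e′) (off′ e≢e′ k≢e′ k≢e′ l≢e′ (≢-sym k≢e) k≢l)
                      (off k≢e (≢-sym e≢e′) k≢e l≢e k≢e′ k≢l)
      reference : ∀ {x y} → x ≢ y → transpose x y ~ transpose k l
      reference {x} {y} x≢y with x ≟ e | y ≟ e | x ≟ e′ | y ≟ e′
      ... | no x≢e   | no y≢e   | _         | _         = off x≢e y≢e k≢e l≢e x≢y k≢l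
      ... | _        | _        | no x≢e′   | no y≢e′   = off′ x≢e′ y≢e′ k≢e′ l≢e′ x≢y k≢l
      ... | yes refl | _        | _         | yes refl  = e-e′
      ... | _        | yes refl | yes refl  | _         = transpose-~-sym e-e′
      ... | yes refl | _        | yes refl  | _         = contradiction refl e≢e′
      ... | _        | yes refl | _         | yes refl  = contradiction refl e≢e′

  -- Young subgroups, and families of sets closed under translation.

  module _ {n : ℕ} where

    -- The cut lies just after `toℕ w`, counted from 0, so the n values of w are exactly the cuts of
    -- n + 1 points into two nonempty sides; `Preserves w` is the Young subgroup of the cut.
    isLow : Fin n → Fin (suc n) → Bool
    isLow w x = toℕ x ≤ᵇ toℕ w

    Preserves : Fin n → Permutation′ (suc n) → Set
    Preserves w ζ = ∀ x → isLow w (ζ ⟨$⟩ʳ x) ≡ isLow w x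

    preserves-transpose : ∀ {w x y} → isLow w x ≡ isLow w y → Preserves w (transpose x y)
    preserves-transpose {w} {x} {y} eq z with transposeView x y z
    ... | first         = trans (cong (isLow w) (transpose-first x y)) (sym eq)
    ... | second        = trans (cong (isLow w) (transpose-second x y)) eq
    ... | other z≢x z≢y = cong (isLow w) (transpose-other z≢x z≢y)

    swap-at : Fin n → Permutation′ (suc n)
    swap-at w = transpose (inject₁ w) (suc w)

  -- Whichever point e is excluded, two of the three remain, and their transposition lies in the
  -- Young subgroup. The points 3, 4, 5 serve for the first two cuts and 0, 1, 2 for all others.
  three-on-one-side : ∀ {m} (w : Fin (5 + m)) → ∃ λ (t : Fin 3 → Fin (6 + m)) →
                      Injective _≡_ _≡_ t × ∃ λ b → ∀ i → isLow w (t i) ≡ b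
  three-on-one-side {m} 0F            = (3 ↑ʳ_) ∘ (_↑ˡ m) ,
    Fin.↑ˡ-injective m _ _ ∘ Fin.↑ʳ-injective 3 _ _ , false , λ _ → refl
  three-on-one-side {m} 1F            = (3 ↑ʳ_) ∘ (_↑ˡ m) ,
    Fin.↑ˡ-injective m _ _ ∘ Fin.↑ʳ-injective 3 _ _ , false , λ _ → refl
  three-on-one-side {m} (suc (suc w)) = (_↑ˡ (3 + m)) ,
    Fin.↑ˡ-injective (3 + m) _ _ , true , λ { 0F → refl ; 1F → refl ; 2F → refl }

  same-side-pair : ∀ {m} (w : Fin (5 + m)) (e : Fin (6 + m)) →
                   ∃₂ λ k l → k ≢ l × k ≢ e × l ≢ e × isLow w k ≡ isLow w l
  same-side-pair w e with three-on-one-side w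
  ... | t , t-inj , b , side with t 0F ≟ e | t 1F ≟ e
  ...   | no p     | no q     = t 0F , t 1F , (λ eq → case t-inj eq of λ ()) , p , q , trans (side 0F) (sym (side 1F))
  ...   | yes refl | _        = t 1F , t 2F , (λ eq → case t-inj eq of λ ()) , (λ eq → case t-inj eq of λ ()) ,
                                (λ eq → case t-inj eq of λ ()) , trans (side 1F) (sym (side 2F))
  ...   | no p     | yes refl = t 0F , t 2F , (λ eq → case t-inj eq of λ ()) , p ,
                                (λ eq → case t-inj eq of λ ()) , trans (side 0F) (sym (side 2F))

  record TranslationClosed (n N : ℕ) (ℓ : Level) : Set (lsuc ℓ) where
    field
      Z      : Fin N → Permutation′ n → Set ℓ
      Z-resp : ∀ i {ζ ζ′} → ζ Perm.≈ ζ′ → Z i ζ → Z i ζ′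
      ρ      : Permutation′ n → Fin N → Fin N
      Z-ρ    : ∀ π i ζ → Z (ρ π i) ζ ⇔ Z i (flip π ⊙ ζ)

    Z-cong : ∀ i {ζ ζ′} → ζ Perm.≈ ζ′ → Z i ζ ⇔ Z i ζ′
    Z-cong i ζ≈ζ′ = mk⇔ (Z-resp i ζ≈ζ′) (Z-resp i (sym ∘ ζ≈ζ′))

    congruence : Fin N → LeftCongruence n ℓ
    congruence i = record
      { _~_           = λ g h → ∀ ζ → Z i (flip g ⊙ ζ) ⇔ Z i (flip h ⊙ ζ)
      ; isEquivalence = record
          { refl  = λ ζ → ⇔-id _
          ; sym   = λ p ζ → ⇔-sym (p ζ)
          ; trans = λ p q ζ → q ζ ⇔-∘ p ζ }
      ; ≈⇒~           = λ {g} {h} g≈h ζ → Z-cong i (λ x → ≈-flip {g = g} {h} g≈h (ζ ⟨$⟩ʳ x))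
      ; ⊙-congˡ       = λ k {g} {h} p ζ →
          Z-cong i (λ _ → refl) ⇔-∘ (p (flip k ⊙ ζ) ⇔-∘ Z-cong i (λ _ → refl))
      }

    -- The translate by g is the set numbered `ρ g i`, so equal numbers mean equal translates. This
    -- is how N bounds the index of the stabilizer.
    ρ-reflects : ∀ i {g h} → ρ g i ≡ ρ h i → LeftCongruence._~_ (congruence i) g h
    ρ-reflects i {g} {h} eq ζ =
      Z-ρ h i ζ ⇔-∘ (subst (λ j → Z (ρ g i) ζ ⇔ Z j ζ) eq (⇔-id _) ⇔-∘ ⇔-sym (Z-ρ g i ζ))

    Translate : Permutation′ n → Fin N → Fin N → Set ℓ
    Translate k i i′ = ∀ ζ → Z i ζ ⇔ Z i′ (k ⊙ ζ)

    translate-ρ : ∀ {g g′ i i′} → ρ g i ≡ ρ g′ i′ → Translate (flip g′ ⊙ g) i i′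
    translate-ρ {g} {g′} {i} {i′} eq ζ =
      Z-cong i′ (λ _ → refl) ⇔-∘ (Z-ρ g′ i′ (g ⊙ ζ) ⇔-∘
      (subst (λ j → Z (ρ g i) (g ⊙ ζ) ⇔ Z j (g ⊙ ζ)) eq (⇔-id _) ⇔-∘
      (⇔-sym (Z-ρ g i (g ⊙ ζ)) ⇔-∘ Z-cong i (λ x → sym (inverseˡ g)))))

    -- The stabilizers of a set and of its translate by k are conjugate under k, and their
    -- exceptional points correspond.
    translate-alternatingOff : ∀ {k i i′ e} → Translate k i i′ →
      AlternatingOff (congruence i′) e → AlternatingOff (congruence i) (k ⟨$⟩ˡ e)
    translate-alternatingOff {k} {i} {i′} {e} T off x≢ y≢ z≢ w≢ x≢y z≢w ζ =
      ⇔-sym (shift _ _) ⇔-∘ (off (move x≢) (move y≢) (move z≢) (move w≢)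
        (x≢y ∘ permutation-injective k) (z≢w ∘ permutation-injective k) (k ⊙ ζ) ⇔-∘ shift _ _)
      where
      move : ∀ {x} → x ≢ k ⟨$⟩ˡ e → k ⟨$⟩ʳ x ≢ e
      move x≢ eq = x≢ (trans (sym (inverseˡ k)) (cong (k ⟨$⟩ˡ_) eq))
      shift : ∀ x y → Z i (flip (transpose x y) ⊙ ζ) ⇔ Z i′ (flip (transpose (k ⟨$⟩ʳ x) (k ⟨$⟩ʳ y)) ⊙ k ⊙ ζ)
      shift x y = Z-cong i′ (λ z → ⊙-transpose k y x (ζ ⟨$⟩ʳ z)) ⇔-∘ T (flip (transpose x y) ⊙ ζ)

  -- Counting the translates of the separating sets.

  module _ {m : ℕ} (𝒵 : TranslationClosed (6 + m) N ℓ) where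
    open TranslationClosed 𝒵

    record Separates (w : Fin (5 + m)) : Set ℓ where
      field
        row     : Fin N
        vanish  : ∀ ζ → Preserves w ζ → Z row ζ
        witness : ¬ Z row (swap-at w)
        point   : Fin (6 + m)
        off     : AlternatingOff (congruence row) point

      open LeftCongruence (congruence row)

      -- By `two-cosets`, u is congruent to the transposition of the point and its image, possibly
      -- times (k l). With k and l on one side, both candidates lie in the Young subgroup as soon as
      -- the point and its image are on one side, too.
      vanish-side : ∀ u → isLow w (u ⟨$⟩ʳ point) ≡ isLow w point → Z row (flip u)
      vanish-side u side =
        let k , l , k≢l , k≢p , l≢p , kl = same-side-pair w point
            t = transpose point (u ⟨$⟩ʳ point)
            t-preserves : Preserves w (flip t)
            t-preserves = preserves-transpose {w = w} side
        in [ (λ u~t → Z-resp row (λ _ → refl) (Equivalence.from (u~t Perm.id)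
                (Z-resp row (λ _ → refl) (vanish (flip t) t-preserves))))
           , (λ u~tθ → Z-resp row (λ _ → refl) (Equivalence.from (u~tθ Perm.id)
                (Z-resp row (λ _ → refl) (vanish (transpose l k ⊙ flip t)
                  λ x → trans (preserves-transpose {w = w} (sym kl) (t ⟨$⟩ˡ x)) (t-preserves x)))))
           ]′ (two-cosets (congruence row) off k≢l k≢p l≢p u)

      -- Otherwise the swap across the cut would be congruent to a transposition within one side,
      -- which belongs to the Young subgroup.
      ¬all-transpositions : ¬ (∀ {x y z w} → x ≢ y → z ≢ w → transpose x y ~ transpose z w)
      ¬all-transpositions all =
        let k , l , k≢l , _ , _ , kl = same-side-pair w point
        in witness (Z-resp row (transpose-sym (suc w) (inject₁ w))
              (Equivalence.from (all (inject₁≢suc w) k≢l Perm.id)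
                (Z-resp row (λ _ → refl) (vanish (transpose l k) (preserves-transpose {w = w} (sym kl))))))
        where
        inject₁≢suc : ∀ {n} (w : Fin n) → inject₁ w ≢ suc w
        inject₁≢suc (suc w) eq = inject₁≢suc w (Fin.suc-injective eq)

      pointView : point ≡ inject₁ w ⊎ point ≡ suc w
      pointView with point ≟ inject₁ w | point ≟ suc w
      ... | yes p | _     = inj₁ p
      ... | _     | yes q = inj₂ q
      ... | no ¬p | no ¬q = contradiction (Z-resp row (transpose-sym (suc w) (inject₁ w))
              (vanish-side (swap-at w) (cong (isLow w) (transpose-other ¬p ¬q)))) witness

    module _ {w w′ : Fin (5 + m)} (A : Separates w) (A′ : Separates w′) {j j′ : Fin (6 + m)} where
      private
        module A  = Separates A
        module A′ = Separates A′
        g  = transpose A.point j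
        g′ = transpose A′.point j′
        k  = flip g′ ⊙ g

      module _ (eq : ρ g A.row ≡ ρ g′ A′.row) where

        -- The targets are the exceptional points of the common translate; two different ones would
        -- put all transpositions into one coset.
        row-determines-target : j ≡ j′
        row-determines-target with j ≟ j′
        ... | yes p = p
        ... | no ¬p = ⊥-elim (A.¬all-transpositions
          (alternatingOff-both (congruence A.row) A.off (s≤s (s≤s (s≤s (s≤s z≤n)))) moved
            (translate-alternatingOff {k} (translate-ρ eq) A′.off)))
          where
          moved : A.point ≢ k ⟨$⟩ˡ A′.point
          moved e = ¬p (trans (sym (transpose-first A.point j)) (trans (cong (g ⟨$⟩ʳ_) e)
                      (trans (inverseʳ g) (transpose-first A′.point j′))))

        -- k takes the first set to the second and matches their exceptional points. On the same
        -- side, `vanish-side` would put k times the swap into the second set, and so the swap into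
        -- the first.
        ¬same-side-after-swap : isLow w′ (swap-at w ⟨$⟩ʳ A.point) ≢ isLow w′ A′.point
        ¬same-side-after-swap side = A.witness (Equivalence.from (translate-ρ eq (swap-at w))
          (Z-resp A′.row (λ _ → refl) (A′.vanish-side (flip (k ⊙ swap-at w))
            (trans (cong (isLow w′) path) side))))
          where
          path : swap-at w ⟨$⟩ˡ (g ⟨$⟩ˡ (g′ ⟨$⟩ʳ A′.point)) ≡ swap-at w ⟨$⟩ʳ A.point
          path = trans (transpose-sym (suc w) (inject₁ w) (g ⟨$⟩ˡ (g′ ⟨$⟩ʳ A′.point))) (cong (swap-at w ⟨$⟩ʳ_)
            (trans (cong (g ⟨$⟩ˡ_) (trans (transpose-first A′.point j′)
                     (trans (sym row-determines-target) (sym (transpose-first A.point j)))))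
                   (inverseˡ g {A.point})))

    module _ (separates : ∀ w → Separates w) where
      private
        module A w = Separates (separates w)

      side : Fin (5 + m) → Fin 2
      side w with A.pointView w
      ... | inj₁ _ = 0F
      ... | inj₂ _ = 1F

      code : Fin (6 + m) → Fin (5 + m) → Fin (N * 2)
      code j w = Fin.combine (ρ (transpose (A.point w) j) (A.row w)) (side w)

      isLow-true : ∀ {w : Fin (5 + m)} {x} → toℕ x ≤ toℕ w → isLow w x ≡ true
      isLow-true {w} {x} = dec-true (toℕ x ℕ.≤? toℕ w)

      isLow-false : ∀ {w : Fin (5 + m)} {x} → toℕ w < toℕ x → isLow w x ≡ false
      isLow-false {w} {x} w<x = dec-false (toℕ x ℕ.≤? toℕ w) (ℕ.<⇒≱ w<x)

      -- A lower end swapped at w is still below the cut w′, and an upper end swapped at w′ is still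
      -- above the cut w. The two cases therefore use `¬same-side-after-swap` in opposite
      -- directions.
      ¬code-< : ∀ {j j′ w w′} → toℕ w < toℕ w′ →
                ρ (transpose (A.point w) j) (A.row w) ≡ ρ (transpose (A.point w′) j′) (A.row w′) →
                side w ≢ side w′
      ¬code-< {j} {j′} {w} {w′} w<w′ eq same with A.pointView w | A.pointView w′
      ... | inj₁ p | inj₁ p′ = ¬same-side-after-swap (separates w) (separates w′) eq
        (trans (isLow-true (ℕ.≤-trans (ℕ.≤-reflexive (cong toℕ (trans (cong (swap-at w ⟨$⟩ʳ_) p) (transpose-first (inject₁ w) (suc w))))) w<w′))
          (sym (isLow-true (ℕ.≤-reflexive (trans (cong toℕ p′) (Fin.toℕ-inject₁ w′))))))
      ... | inj₂ p | inj₂ p′ = ¬same-side-after-swap (separates w′) (separates w) (sym eq)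
        (trans (isLow-false (ℕ.≤-trans w<w′ (ℕ.≤-reflexive (sym (trans (cong toℕ (trans (cong (swap-at w′ ⟨$⟩ʳ_) p′) (transpose-second (inject₁ w′) (suc w′)))) (Fin.toℕ-inject₁ w′))))))
          (sym (isLow-false (ℕ.≤-reflexive (sym (cong toℕ p))))))
      ... | inj₁ _ | inj₂ _ = case same of λ ()
      ... | inj₂ _ | inj₁ _ = case same of λ ()

      code-injective : ∀ {j j′ w w′} → code j w ≡ code j′ w′ → (j , w) ≡ (j′ , w′)
      code-injective {j} {j′} {w} {w′} eq with Fin.combine-injective _ (side w) _ (side w′) eq
      ... | row≡ , side≡ with ℕ.<-cmp (toℕ w) (toℕ w′)
      ...   | tri< w<w′ _ _ = contradiction side≡ (¬code-< w<w′ row≡)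
      ...   | tri> _ _ w′<w = contradiction (sym side≡) (¬code-< w′<w (sym row≡))
      ...   | tri≈ _ w≡w′ _ = cong₂ _,_ (row-determines-target (separates w) (separates w′) row≡) (Fin.toℕ-injective w≡w′)

      separates⇒≤ : (6 + m) * (5 + m) ≤ N * 2
      separates⇒≤ = Fin.injective⇒≤ {f = λ s → code (proj₁ (Fin.remQuot {6 + m} (5 + m) s)) (proj₂ (Fin.remQuot {6 + m} (5 + m) s))}
        λ {s} {s′} eq → remQuot-injective {6 + m} (5 + m) (code-injective eq)

  -- The facet functional on the vertices.

  ℕ-sum-mono-≤ : ∀ {k} {f g : Fin k → ℕ} → (∀ i → f i ℕ.≤ g i) → ℕ-sum f ℕ.≤ ℕ-sum g
  ℕ-sum-mono-≤ {zero}  f≤g = z≤n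
  ℕ-sum-mono-≤ {suc k} f≤g = ℕ.+-mono-≤ (f≤g zero) (ℕ-sum-mono-≤ (f≤g ∘ suc))

  ℕ-sum-mono-< : ∀ {k} {f g : Fin k → ℕ} → (∀ i → f i ℕ.≤ g i) → ∀ j → f j ℕ.< g j → ℕ-sum f ℕ.< ℕ-sum g
  ℕ-sum-mono-< {suc k} f≤g zero    f<g = ℕ.+-mono-<-≤ f<g (ℕ-sum-mono-≤ (f≤g ∘ suc))
  ℕ-sum-mono-< {suc k} f≤g (suc j) f<g = ℕ.+-mono-≤-< (f≤g zero) (ℕ-sum-mono-< (f≤g ∘ suc) j f<g)

  bit : Bool → ℕ
  bit b = if b then 1 else 0

  -- The two factors of ([x ≤ w] - b) (x - w) never have the same sign; the resulting inequality is
  -- expanded and freed of subtraction.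
  bit-exchange : ∀ {x w} (d : Dec (x ℕ.≤ w)) b →
                 bit (does d) ℕ.* suc x ℕ.+ bit b ℕ.* suc w ℕ.≤ bit b ℕ.* suc x ℕ.+ bit (does d) ℕ.* suc w
  bit-exchange (yes _)   true  = ℕ.≤-refl
  bit-exchange (no _)    false = ℕ.≤-refl
  bit-exchange {x} {w} (yes x≤w) false
    rewrite ℕ.+-identityʳ (suc x ℕ.+ 0) | ℕ.+-identityʳ x | ℕ.+-identityʳ w = s≤s x≤w
  bit-exchange {x} {w} (no x≰w)  true
    rewrite ℕ.+-identityʳ (suc x ℕ.+ 0) | ℕ.+-identityʳ x | ℕ.+-identityʳ w = s≤s (ℕ.<⇒≤ (ℕ.≰⇒> x≰w))

  bit-exchange-strict : ∀ w → bit false ℕ.* suc (suc w) ℕ.+ bit true ℕ.* suc w ℕ.<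
                              bit true ℕ.* suc (suc w) ℕ.+ bit false ℕ.* suc w
  bit-exchange-strict w rewrite ℕ.+-identityʳ (suc (suc w) ℕ.+ 0) | ℕ.+-identityʳ w = ℕ.≤-refl

  module _ (w : Fin n) where

    lowBit : Fin (suc n) → ℕ
    lowBit x = bit (isLow w x)

    -- The sum of the low coordinates of the vertex ζ, reindexed by u = ζ⁻¹ v so that ζ occurs in
    -- the indicator only.
    facetValue : Permutation′ (suc n) → ℕ
    facetValue ζ = ℕ-sum λ u → lowBit (ζ ⟨$⟩ʳ u) ℕ.* suc (toℕ u)

    facetValue-preserves : ∀ ζ → Preserves w ζ → facetValue ζ ≡ facetValue Perm.id
    facetValue-preserves ζ pres = ℕ-sum-cong-≗ {suc n} λ u → cong (λ b → bit b ℕ.* suc (toℕ u)) (pres u)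

    private
      W : ℕ
      W = suc (toℕ w)

      weighted : (Fin (suc n) → ℕ) → (Fin (suc n) → ℕ) → Fin (suc n) → ℕ
      weighted α β u = α u ℕ.* suc (toℕ u) ℕ.+ β u ℕ.* W

      -- Both permuted and unpermuted indicator have the same sum, so that adding
      -- W times the other one on either side allows a termwise comparison.
      compensated : ∀ ζ → ∃ λ s → ℕ-sum (weighted lowBit (lowBit ∘ (ζ ⟨$⟩ʳ_))) ≡ facetValue Perm.id ℕ.+ s ×
                                  ℕ-sum (weighted (lowBit ∘ (ζ ⟨$⟩ʳ_)) lowBit) ≡ facetValue ζ ℕ.+ s
      compensated ζ = ℕ-sum {suc n} (λ u → lowBit u ℕ.* W) ,
        ≡.trans (ℕ-∑-distrib-+ {suc n} (λ u → lowBit u ℕ.* suc (toℕ u)) (λ u → lowBit (ζ ⟨$⟩ʳ u) ℕ.* W)) (cong (facetValue Perm.id ℕ.+_) (≡.sym (ℕ-sum-permute (λ u → lowBit u ℕ.* W) ζ))) ,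
        ℕ-∑-distrib-+ {suc n} (λ u → lowBit (ζ ⟨$⟩ʳ u) ℕ.* suc (toℕ u)) (λ u → lowBit u ℕ.* W)

      termwise : ∀ ζ u → weighted lowBit (lowBit ∘ (ζ ⟨$⟩ʳ_)) u ℕ.≤ weighted (lowBit ∘ (ζ ⟨$⟩ʳ_)) lowBit u
      termwise ζ u = bit-exchange (toℕ u ℕ.≤? toℕ w) (isLow w (ζ ⟨$⟩ʳ u))

    facetValue-minimal : ∀ ζ → facetValue Perm.id ℕ.≤ facetValue ζ
    facetValue-minimal ζ with compensated ζ
    ... | s , p , q = ℕ.+-cancelʳ-≤ s _ _ (≡.subst₂ ℕ._≤_ p q (ℕ-sum-mono-≤ {f = weighted lowBit (lowBit ∘ (ζ ⟨$⟩ʳ_))} {weighted (lowBit ∘ (ζ ⟨$⟩ʳ_)) lowBit} (termwise ζ)))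

    facetValue-swap : facetValue Perm.id ℕ.< facetValue (swap-at w)
    facetValue-swap with compensated (swap-at w)
    -- At `inject₁ w`, whose weight is `W` itself, both sides agree; the strict gain is at `suc w`.
    ... | s , p , q = ℕ.+-cancelʳ-< s _ _ (≡.subst₂ ℕ._<_ p q (ℕ-sum-mono-< {f = weighted lowBit (lowBit ∘ (swap-at w ⟨$⟩ʳ_))} {weighted (lowBit ∘ (swap-at w ⟨$⟩ʳ_)) lowBit} (termwise (swap-at w)) (suc w) strict))
      where
      swapped : isLow w (swap-at w ⟨$⟩ʳ suc w) ≡ true
      swapped = ≡.trans (cong (isLow w) (transpose-second (inject₁ w) (suc w)))
                        (dec-true (toℕ (inject₁ w) ℕ.≤? toℕ w) (ℕ.≤-reflexive (Fin.toℕ-inject₁ w)))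
      unswapped : isLow w (suc w) ≡ false
      unswapped = dec-false (toℕ (suc w) ℕ.≤? toℕ w) (ℕ.<-irrefl ≡.refl)
      strict : weighted lowBit (lowBit ∘ (swap-at w ⟨$⟩ʳ_)) (suc w) ℕ.< weighted (lowBit ∘ (swap-at w ⟨$⟩ʳ_)) lowBit (suc w)
      strict = ≡.subst₂ (λ b b′ → bit b′ ℕ.* suc (suc (toℕ w)) ℕ.+ bit b ℕ.* W ℕ.< bit b ℕ.* suc (suc (toℕ w)) ℕ.+ bit b′ ℕ.* W)
                 (≡.sym swapped) (≡.sym unswapped) (bit-exchange-strict (toℕ w))

  -- Return times of injective maps, and numerical estimates.

  iterate : ∀ {a} {A : Set a} → (A → A) → ℕ → A → A
  iterate f zero    x = x
  iterate f (suc k) x = f (iterate f k x)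

  iterate-+ : ∀ {a} {A : Set a} (f : A → A) k l x → iterate f (k ℕ.+ l) x ≡ iterate f k (iterate f l x)
  iterate-+ f zero    l x = ≡.refl
  iterate-+ f (suc k) l x = cong f (iterate-+ f k l x)

  iterate-injective : ∀ {m} {g : Fin m → Fin m} → Injective _≡_ _≡_ g → ∀ k → Injective _≡_ _≡_ (iterate g k)
  iterate-injective g-inj zero    e = e
  iterate-injective g-inj (suc k) e = iterate-injective g-inj k (g-inj e)

  -- Both maps have to return after the same number of steps, so the pigeonhole principle is applied
  -- to pairs of a point φᵗ i and a whole function fᵗ. Injectivity cancels the steps before the
  -- first of the two coinciding times.
  injective-iterates-return : ∀ {N n} {φ : Fin N → Fin N} {f : Fin n → Fin n} →
    Injective _≡_ _≡_ φ → Injective _≡_ _≡_ f → ∀ i →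
    ∃ λ k → φ (iterate φ k i) ≡ i × (∀ x → f (iterate f k x) ≡ x)
  injective-iterates-return {N} {n} {φ} {f} φ-inj f-inj i
    with Fin.pigeonhole (ℕ.n<1+n (N ℕ.* (n ℕ.^ n))) (λ t → Fin.combine (iterate φ (toℕ t) i) (Fin.funToFin (iterate f (toℕ t))))
  ... | s , t , s<t , eq with Fin.combine-injective (iterate φ (toℕ s) i) _ (iterate φ (toℕ t) i) _ eq | ℕ.m≤n⇒∃[o]m+o≡n s<t
  ...   | φ≡ , f≡ | k , k≡ = k ,
    iterate-injective φ-inj (toℕ s) (split φ i (≡.sym φ≡)) ,
    λ x → iterate-injective f-inj (toℕ s) (split f x (≡.trans (≡.sym (Fin.finToFun-funToFin (iterate f (toℕ t)) x))
            (≡.trans (cong (λ c → Fin.finToFun c x) (≡.sym f≡)) (Fin.finToFun-funToFin (iterate f (toℕ s)) x))))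
    where
    split : ∀ {m} (g : Fin m → Fin m) x → iterate g (toℕ t) x ≡ iterate g (toℕ s) x →
            iterate g (toℕ s) (g (iterate g k x)) ≡ iterate g (toℕ s) x
    split g x e = ≡.trans (≡.sym (iterate-+ g (toℕ s) (suc k) x))
      (≡.trans (cong (λ m → iterate g m x) (≡.trans (ℕ.+-suc (toℕ s) k) k≡)) e)

  halve : ∀ m → ∃ λ j → m ≤ j + j × j + j ≤ suc m
  halve zero          = 0 , z≤n , z≤n
  halve (suc zero)    = 1 , s≤s z≤n , s≤s (s≤s z≤n)
  halve (suc (suc m)) with halve m
  ... | j , m≤2j , 2j≤1+m = suc j ,
    s≤s (ℕ.≤-trans (s≤s m≤2j) (ℕ.≤-reflexive (≡.sym (ℕ.+-suc j j)))) ,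
    s≤s (ℕ.≤-trans (ℕ.≤-reflexive (ℕ.+-suc j j)) (s≤s 2j≤1+m))

  -- Here n = 6 + 2 j. The case j = 0 is 30 ≤ 32 and would fail without the summand 2 contributed by
  -- the variables; afterwards the factorial outgrows the left side.
  !-bound : ∀ j → (6 + (j + j)) * (5 + (j + j)) ≤ 4 * (2 + (3 + j) !)
  !-bound zero    = ℕ.m≤m+n 30 2
  !-bound (suc j) = begin
    (6 + (suc j + suc j)) * (5 + (suc j + suc j))
      ≡⟨ solve 1 (λ j → (con 6 :+ (con 1 :+ j :+ (con 1 :+ j))) :* (con 5 :+ (con 1 :+ j :+ (con 1 :+ j))) :=
                        (con 6 :+ (j :+ j)) :* (con 5 :+ (j :+ j)) :+ (con 26 :+ con 8 :* j)) refl j ⟩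
    (6 + (j + j)) * (5 + (j + j)) + (26 + 8 * j)
      ≤⟨ ℕ.+-mono-≤ (!-bound j) small ⟩
    4 * (2 + f) + (12 + 4 * j) * f
      ≡⟨ solve 2 (λ j f → con 4 :* (con 2 :+ f) :+ (con 12 :+ con 4 :* j) :* f :=
                          con 4 :* (con 2 :+ (con 4 :+ j) :* f)) refl j f ⟩
    4 * (2 + (4 + j) * f) ∎
    where
    open ℕ.≤-Reasoning
    open +-*-Solver
    f = (3 + j) !
    small : 26 + 8 * j ≤ (12 + 4 * j) * f
    small = begin
      26 + 8 * j            ≤⟨ ℕ.m≤m+n (26 + 8 * j) (46 + 16 * j) ⟩
      26 + 8 * j + (46 + 16 * j) ≡⟨ solve 1 (λ j → con 26 :+ con 8 :* j :+ (con 46 :+ con 16 :* j) := (con 12 :+ con 4 :* j) :* con 6) refl j ⟩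
      (12 + 4 * j) * 6      ≤⟨ ℕ.*-monoʳ-≤ (12 + 4 * j) (6≤ j) ⟩
      (12 + 4 * j) * f      ∎
      where
      6≤ : ∀ j → 6 ≤ (3 + j) !
      6≤ zero    = ℕ.≤-refl
      6≤ (suc j) = ℕ.≤-trans (6≤ j) (ℕ.m≤m+n ((3 + j) !) ((3 + j) * (3 + j) !))

  module _ {m N : ℕ} (small : 4 * (2 + N) < (6 + m) * (5 + m)) where
    open ℕ.≤-Reasoning
    open +-*-Solver

    -- k is half of n rounded up: the largest value that Bochert's argument admits, while n ≤ 2 k
    -- reduces odd n to `!-bound`.
    small⇒<! : ∃ λ k → k + k ≤ 7 + m × N < k !
    small⇒<! with halve m
    ... | j , m≤2j , 2j≤1+m = 3 + j ,
      (begin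
        3 + j + (3 + j) ≡⟨ solve 1 (λ j → con 3 :+ j :+ (con 3 :+ j) := con 6 :+ (j :+ j)) refl j ⟩
        6 + (j + j)     ≤⟨ ℕ.+-monoʳ-≤ 6 2j≤1+m ⟩
        7 + m           ∎) ,
      ℕ.+-cancelˡ-< 2 N _ (ℕ.*-cancelˡ-< 4 (2 + N) _ (begin-strict
        4 * (2 + N)                   <⟨ small ⟩
        (6 + m) * (5 + m)             ≤⟨ ℕ.*-mono-≤ (ℕ.+-monoʳ-≤ 6 m≤2j) (ℕ.+-monoʳ-≤ 5 m≤2j) ⟩
        (6 + (j + j)) * (5 + (j + j)) ≤⟨ !-bound j ⟩
        4 * (2 + (3 + j) !)           ∎))

    -- n (n - 1) ≤ 2 (n - 1) (n - 2): the spare factor two pays for the point c that is left out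
    -- when pairs are counted.
    small⇒<pairs : N * 2 < (5 + m) * (4 + m)
    small⇒<pairs = ℕ.*-cancelˡ-< 2 (N * 2) _ (ℕ.+-cancelʳ-< 8 _ _ (begin-strict
      2 * (N * 2) + 8                       ≡⟨ solve 1 (λ N → con 2 :* (N :* con 2) :+ con 8 := con 4 :* (con 2 :+ N)) refl N ⟩
      4 * (2 + N)                           <⟨ small ⟩
      (6 + m) * (5 + m)                     ≤⟨ ℕ.m≤m+n _ (m * m + 7 * m + 18) ⟩
      (6 + m) * (5 + m) + (m * m + 7 * m + 18)
        ≡⟨ solve 1 (λ m → (con 6 :+ m) :* (con 5 :+ m) :+ (m :* m :+ con 7 :* m :+ con 18) :=
                          con 2 :* ((con 5 :+ m) :* (con 4 :+ m)) :+ con 8) refl m ⟩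
      2 * ((5 + m) * (4 + m)) + 8           ∎))

    small⇒<twice : N * 2 < (6 + m) * (5 + m)
    small⇒<twice = ℕ.<-≤-trans small⇒<pairs (ℕ.*-mono-≤ (ℕ.n≤1+n (5 + m)) (ℕ.n≤1+n (4 + m)))

open SymmetricGroup

-- Ordered field arithmetic and extrapolation along a line.

module RealFieldProperties {c ℓ₁ ℓ₂} (ℝ : RealField c ℓ₁ ℓ₂) where

  open RealField ℝ hiding (zero)
  open Polyhedra ℝ
  open Algebra.Properties.Semiring.Sum semiring using (sum; sum-cong-≋; ∑-distrib-+; *-distribˡ-sum)
  open Algebra.Properties.Semiring.Mult semiring using (×-homo-+) renaming (_×_ to _×ℝ_)
  open Algebra.Properties.Ring ring using (-1*x≈-x; -‿involutive)
  open IsStrictTotalOrder isStrictTotalOrder using (compare; isStrictPartialOrder; irrefl; asym)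
  open Algebra.Solver.Ring.NaturalCoefficients.Default commutativeSemiring using (solve; _:=_; _:+_; _:*_)

  strictPartialOrder : StrictPartialOrder c ℓ₁ ℓ₂
  strictPartialOrder = record { isStrictPartialOrder = isStrictPartialOrder }

  open Relation.Binary.Reasoning.StrictPartialOrder strictPartialOrder

  <⇒≱ : ∀ {x y} → x < y → ¬ y ≤ x
  <⇒≱ x<y (inj₁ y<x) = asym x<y y<x
  <⇒≱ x<y (inj₂ y≈x) = irrefl (sym y≈x) x<y

  <-irrefl : ∀ {x} → ¬ x < x
  <-irrefl = irrefl refl

  ≤∧≉⇒< : ∀ {x y} → x ≤ y → ¬ x ≈ y → x < y
  ≤∧≉⇒< (inj₁ x<y) _   = x<y
  ≤∧≉⇒< (inj₂ x≈y) x≉y = contradiction x≈y x≉y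

  +-monoʳ-< : ∀ z {x y} → x < y → z + x < z + y
  +-monoʳ-< z {x} {y} x<y = begin-strict
    z + x ≈⟨ +-comm z x ⟩
    x + z <⟨ +-monoˡ-< z x<y ⟩
    y + z ≈⟨ +-comm y z ⟩
    z + y ∎

  +-monoʳ-≤ : ∀ z {x y} → x ≤ y → z + x ≤ z + y
  +-monoʳ-≤ z (inj₁ x<y) = inj₁ (+-monoʳ-< z x<y)
  +-monoʳ-≤ z (inj₂ x≈y) = inj₂ (+-congˡ x≈y)

  +-monoˡ-≤ : ∀ z {x y} → x ≤ y → x + z ≤ y + z
  +-monoˡ-≤ z (inj₁ x<y) = inj₁ (+-monoˡ-< z x<y)
  +-monoˡ-≤ z (inj₂ x≈y) = inj₂ (+-congʳ x≈y)

  +-mono-≤ : ∀ {x y z w} → x ≤ y → z ≤ w → x + z ≤ y + w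
  +-mono-≤ {x} {y} {z} {w} x≤y z≤w = begin
    x + z ≤⟨ +-monoˡ-≤ z x≤y ⟩
    y + z ≤⟨ +-monoʳ-≤ y z≤w ⟩
    y + w ∎

  +-cancelʳ-< : ∀ z {x y} → x + z < y + z → x < y
  +-cancelʳ-< z {x} {y} p = begin-strict
    x             ≈⟨ back x ⟨
    x + z + - z   <⟨ +-monoˡ-< (- z) p ⟩
    y + z + - z   ≈⟨ back y ⟩
    y             ∎
    where
    back : ∀ w → w + z + - z ≈ w
    back w = trans (+-assoc w z (- z)) (trans (+-congˡ (-‿inverseʳ z)) (+-identityʳ w))

  +-cancelʳ-≤ : ∀ z {x y} → x + z ≤ y + z → x ≤ y
  +-cancelʳ-≤ z {x} {y} p with compare x y
  ... | tri< x<y _ _ = inj₁ x<y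
  ... | tri≈ _ x≈y _ = inj₂ x≈y
  ... | tri> _ _ y<x = contradiction p (<⇒≱ (+-monoˡ-< z y<x))

  0<difference : ∀ {x y} → x < y → 0# < y + - x
  0<difference {x} {y} x<y = begin-strict
    0#      ≈⟨ -‿inverseʳ x ⟨
    x + - x <⟨ +-monoˡ-< (- x) x<y ⟩
    y + - x ∎

  difference-+ : ∀ x y → y + - x + x ≈ y
  difference-+ x y = trans (+-assoc y (- x) x) (trans (+-congˡ (-‿inverseˡ x)) (+-identityʳ y))

  *-monoʳ-< : ∀ {h x y} → 0# < h → x < y → h * x < h * y
  *-monoʳ-< {h} {x} {y} 0<h x<y = begin-strict
    h * x                   ≈⟨ +-identityˡ _ ⟨
    0# + h * x              <⟨ +-monoˡ-< (h * x) (*-pos 0<h (0<difference x<y)) ⟩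
    h * (y + - x) + h * x   ≈⟨ distribˡ h (y + - x) x ⟨
    h * (y + - x + x)       ≈⟨ *-congˡ (difference-+ x y) ⟩
    h * y                   ∎

  *-monoʳ-≤ : ∀ {h x y} → 0# ≤ h → x ≤ y → h * x ≤ h * y
  *-monoʳ-≤ (inj₁ 0<h) (inj₁ x<y) = inj₁ (*-monoʳ-< 0<h x<y)
  *-monoʳ-≤ (inj₂ 0≈h) (inj₁ x<y) = inj₂ (trans (*-congʳ (sym 0≈h)) (trans (zeroˡ _) (trans (sym (zeroˡ _)) (*-congʳ 0≈h))))
  *-monoʳ-≤ _          (inj₂ x≈y) = inj₂ (*-congˡ x≈y)

  0<1 : 0# < 1#
  0<1 with compare 0# 1#
  ... | tri< p _ _ = p
  ... | tri≈ _ p _ = contradiction p 0≉1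
  ... | tri> _ _ 1<0 = contradiction 1<0 (asym (begin-strict
    0#            <⟨ *-pos 0<-1 0<-1 ⟩
    - 1# * - 1#   ≈⟨ -1*x≈-x (- 1#) ⟩
    - (- 1#)      ≈⟨ -‿involutive 1# ⟩
    1#            ∎))
    where
    0<-1 : 0# < - 1#
    0<-1 = begin-strict
      0#        <⟨ 0<difference 1<0 ⟩
      0# + - 1# ≈⟨ +-identityˡ _ ⟩
      - 1#      ∎

  positive-inverse : ∀ {x} → 0# < x → ∃ λ y → 0# < y × x * y ≈ 1#
  positive-inverse {x} 0<x with inverse x (λ x≈0 → irrefl (sym x≈0) 0<x)
  ... | y , xy≈1 with compare 0# y
  ...   | tri< 0<y _ _ = y , 0<y , xy≈1
  ...   | tri≈ _ 0≈y _ = contradiction (trans (sym (zeroʳ x)) (trans (*-congˡ 0≈y) xy≈1)) 0≉1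
  ...   | tri> _ _ y<0 = contradiction 0<1 (asym (begin-strict
    1#     ≈⟨ xy≈1 ⟨
    x * y  <⟨ *-monoʳ-< 0<x y<0 ⟩
    x * 0# ≈⟨ zeroʳ x ⟩
    0#     ∎))

  half : ∃ λ h → 0# < h × h + h ≈ 1#
  half with positive-inverse (begin-strict
      0#      <⟨ 0<1 ⟩
      1#      ≈⟨ +-identityʳ 1# ⟨
      1# + 0# <⟨ +-monoʳ-< 1# 0<1 ⟩
      1# + 1# ∎)
  ... | h , 0<h , 2h≈1 = h , 0<h ,
    trans (+-cong (sym (*-identityˡ h)) (sym (*-identityˡ h))) (trans (sym (distribʳ h 1# 1#)) 2h≈1)

  ×1-mono-≤ : ∀ {k l} → k ℕ.≤ l → k ×ℝ 1# ≤ l ×ℝ 1#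
  ×1-mono-≤ {l = zero}  z≤n       = inj₂ refl
  ×1-mono-≤ {l = suc l} z≤n       = begin
    0#               ≤⟨ ×1-mono-≤ {l = l} z≤n ⟩
    l ×ℝ 1#          ≈⟨ +-identityˡ _ ⟨
    0# + l ×ℝ 1#     ≤⟨ +-monoˡ-≤ _ (inj₁ 0<1) ⟩
    1# + l ×ℝ 1#     ∎
  ×1-mono-≤             (s≤s k≤l) = +-monoʳ-≤ 1# (×1-mono-≤ k≤l)

  ×1-mono-< : ∀ {k l} → k ℕ.< l → k ×ℝ 1# < l ×ℝ 1#
  ×1-mono-< {k} {l} k<l = begin-strict
    k ×ℝ 1#        ≈⟨ +-identityˡ _ ⟨
    0# + k ×ℝ 1#   <⟨ +-monoˡ-< _ 0<1 ⟩
    suc k ×ℝ 1#    ≤⟨ ×1-mono-≤ k<l ⟩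
    l ×ℝ 1#        ∎

  sum-mono-≤ : ∀ {k} {f g : Vector Carrier k} → (∀ i → f i ≤ g i) → sum f ≤ sum g
  sum-mono-≤ {zero}  f≤g = inj₂ refl
  sum-mono-≤ {suc k} f≤g = +-mono-≤ (f≤g zero) (sum-mono-≤ (f≤g ∘ suc))

  sum-×1 : ∀ {k} (f : Fin k → ℕ) → sum (λ i → f i ×ℝ 1#) ≈ ℕ-sum f ×ℝ 1#
  sum-×1 {zero}  f = refl
  sum-×1 {suc k} f = trans (+-congˡ (sum-×1 (f ∘ suc))) (sym (×-homo-+ 1# (f zero) _))

  dot : ∀ {k} → ℝ^ k → ℝ^ k → Carrier
  dot a y = sum (zipWith _*_ a y)

  comb : ∀ {k} → Carrier → ℝ^ k → Carrier → ℝ^ k → ℝ^ k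
  comb α y β z v = α * y v + β * z v

  dot-congʳ : ∀ {k} (a : ℝ^ k) {y z} → y ≈ᵛ z → dot a y ≈ dot a z
  dot-congʳ a y≈z = sum-cong-≋ (λ v → *-congˡ (y≈z v))

  dot-comb : ∀ {k} (a : ℝ^ k) α y β z → dot a (comb α y β z) ≈ α * dot a y + β * dot a z
  dot-comb {k} a α y β z = begin-equality
    sum (λ v → a v * (α * y v + β * z v))
      ≈⟨ sum-cong-≋ {k} (λ v → solve 5 (λ a α y β z → a :* (α :* y :+ β :* z) := α :* (a :* y) :+ β :* (a :* z)) refl (a v) α (y v) β (z v)) ⟩
    sum (λ v → α * (a v * y v) + β * (a v * z v))
      ≈⟨ ∑-distrib-+ {k} (λ v → α * (a v * y v)) (λ v → β * (a v * z v)) ⟩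
    sum (λ v → α * (a v * y v)) + sum (λ v → β * (a v * z v))
      ≈⟨ +-cong (*-distribˡ-sum α (zipWith _*_ a y)) (*-distribˡ-sum β (zipWith _*_ a z)) ⟨
    α * dot a y + β * dot a z ∎

  affine : ∀ {α β} → α + β ≈ 1# → ∀ b → α * b + β * b ≈ b
  affine α+β≈1 b = trans (sym (distribʳ b _ _)) (trans (*-congʳ α+β≈1) (*-identityˡ b))

  -- With ν = − ε this is (1 + ε) r − ε s = r + ε (r − s), freed of subtraction.
  extrapolate : ∀ {ε ν} → ε + ν ≈ 0# → ∀ r s → ((1# + ε) * r + ν * s) + ε * s ≈ r + ε * r
  extrapolate {ε} {ν} ε+ν≈0 r s = begin-equality
    ((1# + ε) * r + ν * s) + ε * s ≈⟨ +-congʳ (+-congʳ (trans (distribʳ r 1# ε) (+-congʳ (*-identityˡ r)))) ⟩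
    ((r + ε * r) + ν * s) + ε * s  ≈⟨ solve 4 (λ r ε ν s → (r :+ ε :* r :+ ν :* s) :+ ε :* s := (r :+ ε :* r) :+ (ε :+ ν) :* s) refl r ε ν s ⟩
    (r + ε * r) + (ε + ν) * s      ≈⟨ +-congˡ (trans (*-congʳ ε+ν≈0) (zeroˡ s)) ⟩
    (r + ε * r) + 0#               ≈⟨ +-identityʳ _ ⟩
    r + ε * r                      ∎

  extrapolate-≤ : ∀ {ε ν r s b} → ε + ν ≈ 0# → 0# < ε → r ≤ b → r + ε * b ≤ b + ε * s → (1# + ε) * r + ν * s ≤ b
  extrapolate-≤ {ε} {ν} {r} {s} {b} ε+ν≈0 0<ε r≤b bound = +-cancelʳ-≤ (ε * s) (begin
    ((1# + ε) * r + ν * s) + ε * s ≈⟨ extrapolate ε+ν≈0 r s ⟩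
    r + ε * r                      ≤⟨ +-monoʳ-≤ r (*-monoʳ-≤ (inj₁ 0<ε) r≤b) ⟩
    r + ε * b                      ≤⟨ bound ⟩
    b + ε * s                      ∎)

  extrapolate-< : ∀ {ε ν r s} → ε + ν ≈ 0# → 0# < ε → r < s → (1# + ε) * r + ν * s < r
  extrapolate-< {ε} {ν} {r} {s} ε+ν≈0 0<ε r<s = +-cancelʳ-< (ε * s) (begin-strict
    ((1# + ε) * r + ν * s) + ε * s ≈⟨ extrapolate ε+ν≈0 r s ⟩
    r + ε * r                      <⟨ +-monoʳ-< r (*-monoʳ-< 0<ε r<s) ⟩
    r + ε * s                      ∎)

  -- The conclusion is ε (b - s) ≤ b - r without subtraction. If s < b, then δ = (b - r) / (b - s)
  -- is the exact limit; if s = b, any positive δ will do.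
  step-bound : ∀ {r s b} → s ≤ b → s ≈ b ⊎ r < b → r ≤ b →
               ∃ λ δ → 0# < δ × (∀ ε → 0# < ε → ε ≤ δ → r + ε * b ≤ b + ε * s)
  step-bound (inj₂ s≈b) _           r≤b = 1# , 0<1 , λ ε _ _ → +-mono-≤ r≤b (inj₂ (*-congˡ (sym s≈b)))
  step-bound (inj₁ s<b) (inj₁ s≈b)  r≤b = contradiction s<b (irrefl s≈b)
  step-bound {r} {s} {b} (inj₁ s<b) (inj₂ r<b) _ with positive-inverse (0<difference s<b)
  ... | g′ , 0<g′ , gg′≈1 = (b + - r) * g′ , *-pos (0<difference r<b) 0<g′ , λ ε 0<ε ε≤δ → begin
    r + ε * b                       ≈⟨ +-congˡ (*-congˡ (difference-+ s b)) ⟨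
    r + ε * (g + s)                 ≈⟨ solve 4 (λ r ε g s → r :+ ε :* (g :+ s) := (r :+ ε :* s) :+ g :* ε) refl r ε g s ⟩
    (r + ε * s) + g * ε             ≤⟨ +-monoʳ-≤ _ (*-monoʳ-≤ (inj₁ (0<difference s<b)) ε≤δ) ⟩
    (r + ε * s) + g * (a * g′)      ≈⟨ solve 6 (λ r ε g s a g′ → (r :+ ε :* s) :+ g :* (a :* g′) := (a :* (g :* g′) :+ r) :+ ε :* s) refl r ε g s a g′ ⟩
    (a * (g * g′) + r) + ε * s      ≈⟨ +-congʳ (+-congʳ (trans (*-congˡ gg′≈1) (*-identityʳ a))) ⟩
    (a + r) + ε * s                 ≈⟨ +-congʳ (difference-+ r b) ⟩
    b + ε * s                       ∎
    where
    a = b + - r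
    g = b + - s

  common-lower-bound : ∀ {k} (δ : Fin k → Carrier) → (∀ i → 0# < δ i) → ∃ λ ε → 0# < ε × (∀ i → ε ≤ δ i)
  common-lower-bound {zero}  δ 0<δ = 1# , 0<1 , λ ()
  common-lower-bound {suc k} δ 0<δ with common-lower-bound (δ ∘ suc) (0<δ ∘ suc)
  ... | ε , 0<ε , ε≤δ with compare ε (δ zero)
  ...   | tri< ε<δ₀ _ _ = ε , 0<ε , λ { zero → inj₁ ε<δ₀ ; (suc i) → ε≤δ i }
  ...   | tri≈ _ ε≈δ₀ _ = ε , 0<ε , λ { zero → inj₂ ε≈δ₀ ; (suc i) → ε≤δ i }
  ...   | tri> _ _ δ₀<ε = δ zero , 0<δ zero , λ { zero → inj₂ refl ; (suc i) → begin
    δ zero    ≤⟨ inj₁ δ₀<ε ⟩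
    ε         ≤⟨ ε≤δ i ⟩
    δ (suc i) ∎ }

-- Symmetric formulations and the tight sets of their inequalities.

module PermutahedronProperties {c ℓ₁ ℓ₂} (ℝ : RealField c ℓ₁ ℓ₂) where
  open RealField ℝ hiding (zero)
  open Polyhedra ℝ
  open RealFieldProperties ℝ
  open Algebra.Properties.Semiring.Sum semiring using (sum; sum-cong-≋; ∑-comm; sum-permute; *-distribˡ-sum; *-distribʳ-sum)
  open Algebra.Properties.Semiring.Mult semiring using (×1-homo-*; ×-congˡ) renaming (_×_ to _×ℝ_)
  open IsStrictTotalOrder isStrictTotalOrder using (_≟_)
  open Relation.Binary.Reasoning.StrictPartialOrder strictPartialOrder

  vertex∈hull : ∀ {n} (ζ : Permutation′ n) → permutahedronVertex ζ ∈ Permutahedron n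
  vertex∈hull ζ = record
    { k           = 1
    ; point       = λ _ → permutahedronVertex ζ
    ; weight      = λ _ → 1#
    ; point∈S     = λ _ → ζ , λ _ → refl
    ; weight≥0    = λ _ → inj₁ 0<1
    ; weight-sum  = +-identityʳ 1#
    ; combination = λ v → sym (trans (+-identityʳ _) (*-identityˡ _))
    }

  permutahedronVertex-cong : ∀ {n} {ζ ζ′ : Permutation′ n} → ζ Perm.≈ ζ′ → permutahedronVertex ζ ≈ᵛ permutahedronVertex ζ′
  permutahedronVertex-cong {ζ = ζ} {ζ′} ζ≈ζ′ v = reflexive (cong (λ u → suc (toℕ u) ×ℝ 1#) (≈-flip {g = ζ} {h = ζ′} ζ≈ζ′ v))

  module _ {n : ℕ} (w : Fin n) where

    facet : ℝ^ (suc n)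
    facet v = lowBit w v ×ℝ 1#

    dot-facet-vertex : ∀ ζ → dot facet (permutahedronVertex ζ) ≈ facetValue w ζ ×ℝ 1#
    dot-facet-vertex ζ = begin-equality
      dot facet (permutahedronVertex ζ)
        ≈⟨ sum-permute (zipWith _*_ facet (permutahedronVertex ζ)) ζ ⟩
      sum (λ u → (lowBit w (ζ ⟨$⟩ʳ u) ×ℝ 1#) * (suc (toℕ (ζ ⟨$⟩ˡ (ζ ⟨$⟩ʳ u))) ×ℝ 1#))
        ≈⟨ sum-cong-≋ {suc n} (λ u → trans
             (*-congˡ (×-congˡ (cong (λ v → suc (toℕ v)) (inverseˡ ζ {u}))))
             (sym (×1-homo-* (lowBit w (ζ ⟨$⟩ʳ u)) (suc (toℕ u))))) ⟩
      sum (λ u → (lowBit w (ζ ⟨$⟩ʳ u) ℕ.* suc (toℕ u)) ×ℝ 1#)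
        ≈⟨ sum-×1 {suc n} (λ u → lowBit w (ζ ⟨$⟩ʳ u) ℕ.* suc (toℕ u)) ⟩
      facetValue w ζ ×ℝ 1# ∎

    facet-valid : ∀ x → x ∈ Permutahedron (suc n) → facetValue w Perm.id ×ℝ 1# ≤ dot facet x
    facet-valid x x∈P = begin
      m                                          ≈⟨ *-identityˡ m ⟨
      1# * m                                     ≈⟨ *-congʳ weight-sum ⟨
      sum weight * m                             ≈⟨ *-distribʳ-sum m weight ⟩
      sum (λ j → weight j * m)                   ≤⟨ sum-mono-≤ (λ j → *-monoʳ-≤ (weight≥0 j) (minimal j)) ⟩
      sum (λ j → weight j * dot facet (point j)) ≈⟨ sum-cong-≋ (λ j → *-distribˡ-sum (weight j) (zipWith _*_ facet (point j))) ⟩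
      sum (λ j → sum (λ v → weight j * (facet v * point j v)))
        ≈⟨ ∑-comm {k} {suc n} (λ j v → weight j * (facet v * point j v)) ⟩
      sum (λ v → sum (λ j → weight j * (facet v * point j v)))
        ≈⟨ sum-cong-≋ {suc n} (λ v → trans (sum-cong-≋ {k} (λ j → swap (weight j) (facet v) (point j v)))
             (sym (*-distribˡ-sum (facet v) (λ j → weight j * point j v)))) ⟩
      sum (λ v → facet v * sum (λ j → weight j * point j v))
        ≈⟨ sum-cong-≋ {suc n} (λ v → *-congˡ {facet v} (combination v)) ⟨
      dot facet x ∎
      where
      open ConvexHull x∈P
      m = facetValue w Perm.id ×ℝ 1#
      swap : ∀ x y z → x * (y * z) ≈ y * (x * z)
      swap x y z = trans (sym (*-assoc x y z)) (trans (*-congʳ (*-comm x y)) (*-assoc y x z))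
      minimal : ∀ j → m ≤ dot facet (point j)
      minimal j = let ζ , eq = point∈S j in begin
        m                                  ≤⟨ ×1-mono-≤ (facetValue-minimal w ζ) ⟩
        facetValue w ζ ×ℝ 1#               ≈⟨ dot-facet-vertex ζ ⟨
        dot facet (permutahedronVertex ζ)  ≈⟨ dot-congʳ facet {point j} eq ⟨
        dot facet (point j)                ∎

  *ᵛ-permute : ∀ {k d} (A : Matrix k d) (κ : Permutation′ d) (ϱ : Permutation′ k) →
               ϱ • map (κ •_) A ≈ᴹ A → ∀ y i → (A *ᵛ (κ • y)) i ≈ (A *ᵛ y) (ϱ ⟨$⟩ˡ i)
  *ᵛ-permute {k} {d} A κ ϱ inv y i = begin-equality
    sum (λ v → A i v * y (κ ⟨$⟩ˡ v))                     ≈⟨ sum-cong-≋ {d} (λ v → *-congʳ (inv i v)) ⟨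
    sum (λ v → A (ϱ ⟨$⟩ˡ i) (κ ⟨$⟩ˡ v) * y (κ ⟨$⟩ˡ v))   ≈⟨ sum-permute (zipWith _*_ (A (ϱ ⟨$⟩ˡ i)) y) (flip κ) ⟨
    (A *ᵛ y) (ϱ ⟨$⟩ˡ i)                                  ∎

  module _ {n : ℕ} (E : ExtendedFormulation (Permutahedron (suc n))) (sym-E : IsSymmetric U (PermutahedronVertices (suc n)) E) where
    open ExtendedFormulation E
    open ModuleMorphisms.IsModuleHomomorphism p-linear using (+ᴹ-homo; *ₗ-homo; ⟦⟧-cong)
    private
      module I π = Invariance (sym-E π _)

    lift : ∀ ζ → ∃ λ y → y ∈ Solutions × p y ≈ᵛ permutahedronVertex ζ
    lift ζ = proj₂ p[Q]≐P (vertex∈hull ζ)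

    p-comb : ∀ α y β z → p (comb α y β z) ≈ᵛ comb α (p y) β (p z)
    p-comb α y β z v = trans (+ᴹ-homo (map (α *_) y) (map (β *_) z) v) (+-cong (*ₗ-homo α y v) (*ₗ-homo β z v))

    p-κ : ∀ π {y ζ} → p y ≈ᵛ permutahedronVertex ζ → p (I.κ π • y) ≈ᵛ permutahedronVertex (π ⊙ ζ)
    p-κ π {y} {ζ} py≈ζ v = trans (I.p-equivariant π y (ζ , py≈ζ) v) (py≈ζ (π ⟨$⟩ˡ v))

    A≤-κ : ∀ π y i → (A≤ *ᵛ (I.κ π • y)) i ≈ (A≤ *ᵛ y) (I.ϱ≤ π ⟨$⟩ˡ i)
    A≤-κ π = *ᵛ-permute A≤ (I.κ π) (I.ϱ≤ π) (I.A≤-invariant π)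

    κ-solution : ∀ π {y} → y ∈ Solutions → I.κ π • y ∈ Solutions
    κ-solution π {y} (eqs , ineqs) =
      (λ i → trans (*ᵛ-permute A⁼ (I.κ π) (I.ϱ⁼ π) (I.A⁼-invariant π) y i)
               (trans (eqs (I.ϱ⁼ π ⟨$⟩ˡ i)) (I.b⁼-invariant π i))) ,
      (λ i → begin
        (A≤ *ᵛ (I.κ π • y)) i        ≈⟨ A≤-κ π y i ⟩
        (A≤ *ᵛ y) (I.ϱ≤ π ⟨$⟩ˡ i)    ≤⟨ ineqs (I.ϱ≤ π ⟨$⟩ˡ i) ⟩
        b≤ (I.ϱ≤ π ⟨$⟩ˡ i)           ≈⟨ I.b≤-invariant π i ⟩
        b≤ i                         ∎)

    -- Quantifying over the fibre replaces an equivariant choice of a point over each vertex: `κ`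
    -- carries the fibre over ζ into the fibre over πζ.
    TightAt : Fin m≤ → Permutation′ (suc n) → Set (c ⊔ ℓ₁ ⊔ ℓ₂)
    TightAt i ζ = ∀ y → y ∈ Solutions → p y ≈ᵛ permutahedronVertex ζ → (A≤ *ᵛ y) i ≈ b≤ i

    tightAt-resp : ∀ i {ζ ζ′} → ζ Perm.≈ ζ′ → TightAt i ζ → TightAt i ζ′
    tightAt-resp i {ζ} {ζ′} ζ≈ζ′ t y y∈Q py = t y y∈Q (λ v → trans (py v) (permutahedronVertex-cong {ζ = ζ′} {ζ} (≡.sym ∘ ζ≈ζ′) v))

    tightAt-translate : ∀ π i ζ → TightAt i (π ⊙ ζ) → TightAt (I.ϱ≤ π ⟨$⟩ˡ i) ζ
    tightAt-translate π i ζ t y y∈Q py = trans (sym (A≤-κ π y i))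
      (trans (t (I.κ π • y) (κ-solution π y∈Q) (p-κ π {y} {ζ} py)) (sym (I.b≤-invariant π i)))

    -- The permutations ϱ≤ need not form an action, but iterating one of them
    -- eventually undoes it.
    tightAt-untranslate : ∀ π i ζ → TightAt (I.ϱ≤ π ⟨$⟩ˡ i) ζ → TightAt i (π ⊙ ζ)
    tightAt-untranslate π i ζ t
      with injective-iterates-return (permutation-injective (flip (I.ϱ≤ π))) (permutation-injective (flip π)) i
    -- `t` sits at index φ i. Here φᵏ⁺¹ i = i and π⁻ᵏ = π, so k further translations by π⁻¹ arrive
    -- at index i and at πζ.
    ... | k , φ≡ , f≡ = tightAt-resp i {powers k} {π ⊙ ζ} (λ x → permutation-injective (flip π)
            (≡.trans (cong (π ⟨$⟩ˡ_) (powers-iterate k x)) (≡.trans (f≡ (ζ ⟨$⟩ʳ x)) (≡.sym (inverseˡ π)))))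
          (subst (λ j → TightAt j (powers k)) (≡.trans (shift k) φ≡) (iterated k))
      where
      φ = I.ϱ≤ π ⟨$⟩ˡ_
      powers : ℕ → Permutation′ (suc n)
      powers zero    = ζ
      powers (suc k) = flip π ⊙ powers k
      powers-iterate : ∀ k x → powers k ⟨$⟩ʳ x ≡ iterate (π ⟨$⟩ˡ_) k (ζ ⟨$⟩ʳ x)
      powers-iterate zero    x = ≡.refl
      powers-iterate (suc k) x = cong (π ⟨$⟩ˡ_) (powers-iterate k x)
      iterated : ∀ k → TightAt (iterate φ k (φ i)) (powers k)
      iterated zero    = t
      iterated (suc k) = tightAt-translate π (iterate φ k (φ i)) (powers (suc k))
        (tightAt-resp (iterate φ k (φ i)) {powers k} {π ⊙ powers (suc k)} (λ x → ≡.sym (inverseʳ π)) (iterated k))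
      shift : ∀ k → iterate φ k (φ i) ≡ φ (iterate φ k i)
      shift zero    = ≡.refl
      shift (suc k) = cong φ (shift k)

    tightSets : TranslationClosed (suc n) m≤ (c ⊔ ℓ₁ ⊔ ℓ₂)
    tightSets = record
      { Z      = TightAt
      ; Z-resp = tightAt-resp
      ; ρ      = λ π i → I.ϱ≤ (flip π) ⟨$⟩ˡ i
      ; Z-ρ    = λ π i ζ → mk⇔ (tightAt-untranslate (flip π) i ζ) (tightAt-translate (flip π) i ζ)
      }

    -- An inequality that separates a facet from a neighbouring vertex.

    module _ (w : Fin n) where
      private
        M = facetValue w Perm.id ×ℝ 1#

        OnFace : ℝ^ numVariables → Set (ℓ₁ ⊔ ℓ₂)
        OnFace y = y ∈ Solutions × dot (facet w) (p y) ≈ M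

        onFace : ∀ {ζ y} → Preserves w ζ → y ∈ Solutions → p y ≈ᵛ permutahedronVertex ζ → OnFace y
        onFace {ζ} {y} pres y∈Q py = y∈Q , trans (dot-congʳ (facet w) py)
          (trans (dot-facet-vertex w ζ) (×-congˡ (facetValue-preserves w ζ pres)))

        face-point : ∃ OnFace
        face-point = let y , y∈Q , py = lift Perm.id in y , onFace {Perm.id} (λ _ → ≡.refl) y∈Q py

        s∈ = lift (swap-at w)
        s = proj₁ s∈
        s∈Q = proj₁ (proj₂ s∈)

        M<s : M < dot (facet w) (p s)
        M<s = begin-strict
          M                                                    <⟨ ×1-mono-< (facetValue-swap w) ⟩
          facetValue w (swap-at w) ×ℝ 1#                       ≈⟨ dot-facet-vertex w (swap-at w) ⟨
          dot (facet w) (permutahedronVertex (swap-at w))      ≈⟨ dot-congʳ (facet w) (proj₂ (proj₂ s∈)) ⟨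
          dot (facet w) (p s)                                  ∎

        -- Row i does not block a small step from y away from s: either it is tight at s, so that
        -- the step cannot increase it, or it has slack at y.
        Loose : Fin m≤ → ℝ^ numVariables → Set (ℓ₁ ⊔ ℓ₂)
        Loose i y = (A≤ *ᵛ s) i ≈ b≤ i ⊎ (A≤ *ᵛ y) i < b≤ i

        comb-equations : ∀ {α β y z} → α + β ≈ 1# → y ∈ Solutions → z ∈ Solutions → A⁼ *ᵛ comb α y β z ≈ᵛ b⁼
        comb-equations {α} {β} {y} {z} α+β≈1 y∈Q z∈Q i = trans (dot-comb (A⁼ i) α y β z)
          (trans (+-cong (*-congˡ (proj₁ y∈Q i)) (*-congˡ (proj₁ z∈Q i))) (affine α+β≈1 (b⁼ i)))

        comb-facet : ∀ α y β z → dot (facet w) (p (comb α y β z)) ≈ α * dot (facet w) (p y) + β * dot (facet w) (p z)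
        comb-facet α y β z = trans (dot-congʳ (facet w) (p-comb α y β z)) (dot-comb (facet w) α (p y) β (p z))

        h = proj₁ half
        0<h = proj₁ (proj₂ half)
        2h≈1 = proj₂ (proj₂ half)

        midpoint : ℝ^ numVariables → ℝ^ numVariables → ℝ^ numVariables
        midpoint y z = comb h y h z

        midpoint-onFace : ∀ {y z} → OnFace y → OnFace z → OnFace (midpoint y z)
        midpoint-onFace {y} {z} (y∈Q , Ly) (z∈Q , Lz) =
          (comb-equations {y = y} {z} 2h≈1 y∈Q z∈Q , λ i → begin
            (A≤ *ᵛ midpoint y z) i             ≈⟨ dot-comb (A≤ i) h y h z ⟩
            h * (A≤ *ᵛ y) i + h * (A≤ *ᵛ z) i  ≤⟨ +-mono-≤ (*-monoʳ-≤ (inj₁ 0<h) (proj₂ y∈Q i)) (*-monoʳ-≤ (inj₁ 0<h) (proj₂ z∈Q i)) ⟩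
            h * b≤ i + h * b≤ i                ≈⟨ affine 2h≈1 (b≤ i) ⟩
            b≤ i                               ∎) ,
          trans (comb-facet h y h z) (trans (+-cong (*-congˡ Ly) (*-congˡ Lz)) (affine 2h≈1 M))

        midpoint-looseˡ : ∀ {y z i} → z ∈ Solutions → Loose i y → Loose i (midpoint y z)
        midpoint-looseˡ z∈Q (inj₁ s≈b) = inj₁ s≈b
        midpoint-looseˡ {y} {z} {i} z∈Q (inj₂ y<b) = inj₂ (begin-strict
          (A≤ *ᵛ midpoint y z) i             ≈⟨ dot-comb (A≤ i) h y h z ⟩
          h * (A≤ *ᵛ y) i + h * (A≤ *ᵛ z) i  <⟨ +-monoˡ-< _ (*-monoʳ-< 0<h y<b) ⟩
          h * b≤ i + h * (A≤ *ᵛ z) i         ≤⟨ +-monoʳ-≤ _ (*-monoʳ-≤ (inj₁ 0<h) (proj₂ z∈Q i)) ⟩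
          h * b≤ i + h * b≤ i                ≈⟨ affine 2h≈1 (b≤ i) ⟩
          b≤ i                               ∎)

        midpoint-looseʳ : ∀ {y z i} → y ∈ Solutions → Loose i z → Loose i (midpoint y z)
        midpoint-looseʳ y∈Q (inj₁ s≈b) = inj₁ s≈b
        midpoint-looseʳ {y} {z} {i} y∈Q (inj₂ z<b) = inj₂ (begin-strict
          (A≤ *ᵛ midpoint y z) i             ≈⟨ dot-comb (A≤ i) h y h z ⟩
          h * (A≤ *ᵛ y) i + h * (A≤ *ᵛ z) i  <⟨ +-monoʳ-< _ (*-monoʳ-< 0<h z<b) ⟩
          h * (A≤ *ᵛ y) i + h * b≤ i         ≤⟨ +-monoˡ-≤ _ (*-monoʳ-≤ (inj₁ 0<h) (proj₂ y∈Q i)) ⟩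
          h * b≤ i + h * b≤ i                ≈⟨ affine 2h≈1 (b≤ i) ⟩
          b≤ i                               ∎)

        -- Slack at one of two points of Q survives at their midpoint, and the face is convex, so
        -- the witnesses of the single rows can be averaged.
        simultaneously-loose : ∀ {k} (f : Fin k → Fin m≤) → (∀ j → ∃ λ y → OnFace y × Loose (f j) y) →
                               ∃ λ y → OnFace y × (∀ j → Loose (f j) y)
        simultaneously-loose {zero}  f each = let y , y∈F = face-point in y , y∈F , λ ()
        simultaneously-loose {suc k} f each =
          let y , y∈F , y-loose = each zero
              z , z∈F , z-loose = simultaneously-loose (f ∘ suc) (each ∘ suc)
          in midpoint y z , midpoint-onFace y∈F z∈F , λ
            { zero    → midpoint-looseˡ {y} {z} (proj₁ z∈F) y-loose
            ; (suc j) → midpoint-looseʳ {y} {z} (proj₁ y∈F) (z-loose j) }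

        -- If z is loose wherever s is, then moving from z slightly away from s
        -- stays inside Q but leaves the half-space of the facet.
        ¬all-loose : ∀ {z} → OnFace z → ¬ (∀ i → Loose i z)
        ¬all-loose {z} (z∈Q , Lz) loose = <⇒≱ (begin-strict
          dot (facet w) (p y)                                               ≈⟨ comb-facet (1# + ε) z (- ε) s ⟩
          (1# + ε) * dot (facet w) (p z) + - ε * dot (facet w) (p s)        ≈⟨ +-congʳ (*-congˡ Lz) ⟩
          (1# + ε) * M + - ε * dot (facet w) (p s)                          <⟨ extrapolate-< (-‿inverseʳ ε) 0<ε M<s ⟩
          M                                                                 ∎)
          (facet-valid w (p y) (proj₁ p[Q]≐P (y , y∈Q , λ _ → refl)))
          where
          bound : ∀ i → ∃ λ δ → 0# < δ × (∀ ε → 0# < ε → ε ≤ δ → (A≤ *ᵛ z) i + ε * b≤ i ≤ b≤ i + ε * (A≤ *ᵛ s) i)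
          bound i = step-bound (proj₂ s∈Q i) (loose i) (proj₂ z∈Q i)
          common = common-lower-bound (λ i → proj₁ (bound i)) (λ i → proj₁ (proj₂ (bound i)))
          ε = proj₁ common
          0<ε = proj₁ (proj₂ common)
          y = comb (1# + ε) z (- ε) s
          weights : (1# + ε) + - ε ≈ 1#
          weights = trans (+-assoc 1# ε (- ε)) (trans (+-congˡ (-‿inverseʳ ε)) (+-identityʳ 1#))
          y∈Q : y ∈ Solutions
          y∈Q = comb-equations {y = z} {s} weights z∈Q s∈Q , λ i → begin
            (A≤ *ᵛ y) i                                      ≈⟨ dot-comb (A≤ i) (1# + ε) z (- ε) s ⟩
            (1# + ε) * (A≤ *ᵛ z) i + - ε * (A≤ *ᵛ s) i       ≤⟨ extrapolate-≤ (-‿inverseʳ ε) 0<ε (proj₂ z∈Q i)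
                                                                  (proj₂ (proj₂ (bound i)) ε 0<ε (proj₂ (proj₂ common) i)) ⟩
            b≤ i                                             ∎

      -- If no row qualifies, then each row is loose at some point of the face: a row that is not
      -- tight at s must have slack somewhere over the Young subgroup. Averaging these points
      -- contradicts `¬all-loose`.
      facet-row : ¬ ¬ ∃ λ i → (∀ ζ → Preserves w ζ → TightAt i ζ) × ¬ TightAt i (swap-at w)
      facet-row none = ¬¬-∀ loose-somewhere λ each →
        let z , z∈F , loose = simultaneously-loose (λ i → i) each in ¬all-loose z∈F loose
        where
        loose-somewhere : ∀ i → ¬ ¬ ∃ λ y → OnFace y × Loose i y
        loose-somewhere i k with (A≤ *ᵛ s) i ≟ b≤ i
        ... | yes s≈b = let y , y∈F = face-point in k (y , y∈F , inj₁ s≈b)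
        ... | no s≉b  = none (i ,
          (λ ζ pres y y∈Q py → decidable-stable ((A≤ *ᵛ y) i ≟ b≤ i) λ y≉b →
            k (y , onFace {ζ} pres y∈Q py , inj₂ (≤∧≉⇒< (proj₂ y∈Q i) y≉b))) ,
          λ t → s≉b (t s s∈Q (proj₂ (proj₂ s∈))))

  -- Only needed for n = 6, where it rules out the exotic subgroup of index 6 in S₆.
  two-variables : ∀ {n} (E : ExtendedFormulation (Permutahedron (suc (suc n)))) →
                  IsSymmetric U (PermutahedronVertices (suc (suc n))) E → 2 ℕ.≤ ExtendedFormulation.numVariables E
  two-variables E sym-E = ℕ.≮⇒≥ λ d<2 → contradiction (begin-strict
      1 ×ℝ 1#        <⟨ ×1-mono-< (ℕ.n<1+n 1) ⟩
      2 ×ℝ 1#        ≈⟨ py 1F ⟨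
      -- The transposition moves entry 1 to entry 0, but on fewer than two variables `κ` is the
      -- identity.
      p y 1F         ≈⟨ p-equivariant y (Perm.id , py) 0F ⟨
      p (κ • y) 0F   ≈⟨ ⟦⟧-cong (λ v → reflexive (cong y (all-equal d<2 (κ ⟨$⟩ˡ v) v))) 0F ⟩
      p y 0F         ≈⟨ py 0F ⟩
      1 ×ℝ 1#        ∎) <-irrefl
    where
    open ExtendedFormulation E
    open Invariance (sym-E (transpose 0F 1F) _)
    open ModuleMorphisms.IsModuleHomomorphism p-linear using (⟦⟧-cong)
    y∈ = lift E sym-E Perm.id
    y = proj₁ y∈
    py = proj₂ (proj₂ y∈)
    all-equal : ∀ {d} → d ℕ.< 2 → (v v′ : Fin d) → v ≡ v′
    all-equal {1} _ zero zero = ≡.refl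
    all-equal {suc (suc d)} (s≤s (s≤s ()))

open import Data.Nat.Base using (ℕ; _+_; _*_; _∸_; _≤_)

theorem11 : ∀ {c ℓ₁ ℓ₂} (ℝ : RealField c ℓ₁ ℓ₂) → let open Polyhedra ℝ in
    (n : ℕ) → 6 ≤ n →
    (E : ExtendedFormulation (Permutahedron n)) →
    IsSymmetric U (PermutahedronVertices n) E →
    let open ExtendedFormulation E in
    n * (n ∸ 1) ≤ 4 * (numVariables + numConstraints)
theorem11 ℝ n 6≤n E sym-E with ℕ.m≤n⇒∃[o]m+o≡n 6≤n
... | m , ≡.refl = decidable-stable (_ ℕ.≤? _) λ ¬bound →
  let open Polyhedra.ExtendedFormulation E
      open PermutahedronProperties ℝ
      small : 4 * (2 + m≤) ℕ.< (6 + m) * (5 + m)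
      small = ℕ.≤-<-trans
        (ℕ.*-monoʳ-≤ 4 (ℕ.+-mono-≤ (two-variables E sym-E) (ℕ.m≤n+m m≤ m⁼)))
        (ℕ.≰⇒> ¬bound)
      𝒵 = tightSets E sym-E
      open TranslationClosed 𝒵
      k , 2k≤1+n , m≤<k! = small⇒<! small
  -- The final count compares different cuts, so the rows for all cuts must be available together.
  in ¬¬-∀ {P = Separates 𝒵} (λ w ¬separates →
       facet-row E sym-E w λ (i , vanish , witness) →
       smallIndex⇒alternatingOff (congruence i) (λ g → ρ g i) (λ {g} {h} → ρ-reflects i {g} {h})
         k 2k≤1+n m≤<k! (small⇒<pairs small) λ (e , off) →
       ¬separates (record { row = i ; vanish = vanish ; witness = witness ; point = e ; off = off }))
     λ separates → ℕ.<⇒≱ (small⇒<twice small) (separates⇒≤ 𝒵 separates)
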